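{- Let $n$ be a natural number, let $p(\lambda)\in\mathbb{Q}[\lambda]$ be any polynomial, and let $A\in M_n(\mathbb{Q})$ have characteristic polynomial $f(\lambda)$ (of degree $n$) which is irreducible over $\mathbb{Q}$. Then the following are equivalent: (i) the equation $p(X)=A$ has a solution $X\in M_n(\mathbb{Q})$; (ii) the polynomial $f(p(\lambda))$ has a factor $h(\lambda)\in\mathbb{Q}[\lambda]$ of degree $n$; (iii) there exist an eigenvalue $\mu\in\sigma(A)$ and an element $\gamma\in\mathbb{Q}(\mu)$ such that $p(\gamma)=\mu$.
   Context: $M_n(\mathbb{Q})$ is the set of $n\times n$ matrices with rational entries. $\sigma(A)$ is the set of eigenvalues of $A$ in a fixed algebraic closure $\overline{\mathbb{Q}}$ of $\mathbb{Q}$, that is, the set of roots of $f(\lambda)$ in $\overline{\mathbb{Q}}$. For $\mu\in\overline{\mathbb{Q}}$, $\mathbb{Q}(\mu)\subset\overline{\mathbb{Q}}$ is the field generated by $\mu$ over $\mathbb{Q}$. A factor of a polynomial over $\mathbb{Q}$ is a polynomial in $\mathbb{Q}[\lambda]$ dividing it in $\mathbb{Q}[\lambda]$. -}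

module Defs where

open import Algebra.Apartness.Bundles using (HeytingField; HeytingCommutativeRing)
open import Algebra.Bundles using (CommutativeRing)
open import Algebra.Bundles.Raw using (RawRing)
open import Algebra.Definitions.RawSemiring as RawSemiringDefinitions using ()
open import Algebra.Morphism.Structures using (IsRingHomomorphism)
open import Data.Bool.Base using (if_then_else_)
open import Data.Fin.Base using (Fin; zero; suc; toℕ)
open import Data.Fin.Properties using (_≟_)
open import Data.List.Base using (List; []; _∷_; foldr; map)
open import Data.Nat.Base using (ℕ; zero; suc; _<_)
open import Data.Product.Base using (∃-syntax; _×_)
open import Data.Rational.Base using (ℚ; +-*-rawRing)
open import Data.Vec.Functional using (Vector; removeAt)
open import Level using (Level; _⊔_) renaming (suc to lsuc)
open import Relation.Nullary.Decidable.Core using (⌊_⌋)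
open import Relation.Nullary.Negation.Core using (¬_)
open import Relation.Unary using (Pred)

-- Univariate polynomials, as lists of coefficients with the constant term
-- first.  Trailing zeros are allowed, so equality is coefficientwise.
module Polynomial {c ℓ : Level} (R : RawRing c ℓ) where
  open RawRing R

  Poly : Set c
  Poly = List Carrier

  coeff : Poly → ℕ → Carrier
  coeff []      _       = 0#
  coeff (a ∷ _) zero    = a
  coeff (_ ∷ p) (suc k) = coeff p k

  infix  4 _≈ₚ_
  infixl 6 _+ₚ_
  infixl 7 _*ₚ_
  infix  8 -ₚ_

  _≈ₚ_ : Poly → Poly → Set ℓ
  p ≈ₚ q = ∀ k → coeff p k ≈ coeff q k

  _+ₚ_ : Poly → Poly → Poly
  []      +ₚ q       = q
  (a ∷ p) +ₚ []      = a ∷ p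
  (a ∷ p) +ₚ (b ∷ q) = (a + b) ∷ (p +ₚ q)

  -ₚ_ : Poly → Poly
  -ₚ_ = map (-_)

  _*ₚ_ : Poly → Poly → Poly
  []      *ₚ q = []
  (a ∷ p) *ₚ q = map (a *_) q +ₚ (0# ∷ (p *ₚ q))

  const : Carrier → Poly
  const a = a ∷ []

  indeterminate : Poly
  indeterminate = 0# ∷ 1# ∷ []

  polyRing : RawRing c ℓ
  polyRing = record
    { Carrier = Poly
    ; _≈_     = _≈ₚ_
    ; _+_     = _+ₚ_
    ; _*_     = _*ₚ_
    ; -_      = -ₚ_
    ; 0#      = []
    ; 1#      = const 1#
    }

  HasDegree : Poly → ℕ → Set ℓ
  HasDegree p d = (coeff p d ≉ 0#) × (∀ k → d < k → coeff p k ≈ 0#)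

  -- The value at an element of S of a polynomial whose coefficients are
  -- sent to S by ι (Horner's scheme).
  eval : ∀ {a b} (S : RawRing a b) → (Carrier → RawRing.Carrier S) →
         Poly → RawRing.Carrier S → RawRing.Carrier S
  eval S ι p x = foldr (λ a y → ι a S.+ (x S.* y)) S.0# p
    where module S = RawRing S

module Matrices {c ℓ : Level} (R : RawRing c ℓ) where
  open RawRing R
  open RawSemiringDefinitions rawSemiring using (sum; _^_)

  Matrix : ℕ → Set c
  Matrix n = Vector (Vector Carrier n) n

  scalar : ∀ {n} → Carrier → Matrix n
  scalar a i j = if ⌊ i ≟ j ⌋ then a else 0#

  matrixRing : ℕ → RawRing c ℓ
  matrixRing n = record
    { Carrier = Matrix n
    ; _≈_     = λ A B → ∀ i j → A i j ≈ B i j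
    ; _+_     = λ A B i j → A i j + B i j
    ; _*_     = λ A B i j → sum (λ k → A i k * B k j)
    ; -_      = λ A i j → - A i j
    ; 0#      = λ _ _ → 0#
    ; 1#      = scalar 1#
    }

  -- Laplace expansion along the first row.
  det : ∀ {n} → Matrix n → Carrier
  det {zero}  A = 1#
  det {suc n} A =
    sum (λ j → ((- 1#) ^ toℕ j) * (A zero j * det (λ i → removeAt (A (suc i)) j)))

module CharacteristicPolynomial {c ℓ : Level} (R : RawRing c ℓ) where
  open Polynomial R using (Poly; polyRing; const; indeterminate)
  open Matrices R using (Matrix)
  private module M = Matrices polyRing

  -- det (λ I - A)
  charPoly : ∀ {n} → Matrix n → Poly
  charPoly {n} A = M.det (M.scalar indeterminate + (- (λ i j → const (A i j))))
    where open RawRing (M.matrixRing n) using (_+_; -_)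

open Polynomial +-*-rawRing public
  using ()
  renaming (Poly to ℚ[λ]; polyRing to ℚ[λ]-rawRing; HasDegree to HasDegreeℚ)
open Matrices +-*-rawRing public
  using ()
  renaming (Matrix to Matℚ; matrixRing to Matℚ-rawRing)
open CharacteristicPolynomial +-*-rawRing public using (charPoly)

open RawSemiringDefinitions (RawRing.rawSemiring ℚ[λ]-rawRing) public
  using (Irreducible; _∣_)

-- f(p(λ))
infixr 9 _∘ₚ_
_∘ₚ_ : ℚ[λ] → ℚ[λ] → ℚ[λ]
f ∘ₚ p = Polynomial.eval +-*-rawRing ℚ[λ]-rawRing (Polynomial.const +-*-rawRing) f p

-- p(X); the constant term of p is multiplied by the identity matrix.
evalMat : ∀ {n} → ℚ[λ] → Matℚ n → Matℚ n
evalMat {n} = Polynomial.eval +-*-rawRing (Matℚ-rawRing n) (Matrices.scalar +-*-rawRing)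

infix 4 _≈ₘ_
_≈ₘ_ : ∀ {n} → Matℚ n → Matℚ n → Set
_≈ₘ_ {n} = RawRing._≈_ (Matℚ-rawRing n)

-- Being algebraic over the discrete field ℚ makes equality on the closure
-- decidable, with _#_ equivalent to _≉_; so HasDegree, stated with _≉_, is
-- the usual notion there too.
record AlgebraicClosureOfℚ (c ℓ₁ ℓ₂ : Level) : Set (lsuc (c ⊔ ℓ₁ ⊔ ℓ₂)) where
  field
    heytingField : HeytingField c ℓ₁ ℓ₂

  open HeytingField heytingField public
    using (Carrier; _≈_; _+_; _*_; -_; 0#; 1#)

  rawRing : RawRing c ℓ₁
  rawRing = CommutativeRing.rawRing
    (HeytingCommutativeRing.commutativeRing
      (HeytingField.heytingCommutativeRing heytingField))

  field
    ι              : ℚ → Carrier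
    ι-homomorphism : IsRingHomomorphism +-*-rawRing rawRing ι

  evalAt : ℚ[λ] → Carrier → Carrier
  evalAt = Polynomial.eval +-*-rawRing rawRing ι

  field
    algebraic : ∀ x → ∃[ q ] (¬ RawRing._≈_ ℚ[λ]-rawRing q (RawRing.0# ℚ[λ]-rawRing))
                           × evalAt q x ≈ 0#
    closed    : ∀ d (q : Polynomial.Poly rawRing) →
                Polynomial.HasDegree rawRing q (suc d) →
                ∃[ x ] Polynomial.eval rawRing rawRing (λ a → a) q x ≈ 0#

  σ : ∀ {n} → Matℚ n → Pred Carrier ℓ₁
  σ A μ = evalAt (charPoly A) μ ≈ 0#

  -- The subfield generated by μ over ℚ.
  data ℚ⟨_⟩ (μ : Carrier) : Pred Carrier (c ⊔ ℓ₁) where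
    rational  : ∀ q → ℚ⟨ μ ⟩ (ι q)
    generator : ℚ⟨ μ ⟩ μ
    sum       : ∀ {x y} → ℚ⟨ μ ⟩ x → ℚ⟨ μ ⟩ y → ℚ⟨ μ ⟩ (x + y)
    negative  : ∀ {x} → ℚ⟨ μ ⟩ x → ℚ⟨ μ ⟩ (- x)
    product   : ∀ {x y} → ℚ⟨ μ ⟩ x → ℚ⟨ μ ⟩ y → ℚ⟨ μ ⟩ (x * y)
    inverse   : ∀ {x y} → ℚ⟨ μ ⟩ x → x * y ≈ 1# → ℚ⟨ μ ⟩ y
    respects  : ∀ {x y} → x ≈ y → ℚ⟨ μ ⟩ x → ℚ⟨ μ ⟩ y

module Submission where

-- Each of (i), (ii) and (iii) is equivalent to the solvability of p(q(λ)) ≡ λ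
-- modulo f by some q ∈ ℚ[λ].  If f is irreducible and lies in a proper ideal J
-- of ℚ[λ], then J = (f); this is applied to the annihilator of the first basis
-- vector e₀ under A, to the polynomials vanishing at μ, and to
-- { g : h divides g(p(λ)) }.
-- (i): e₀ is cyclic for A, so X e₀ = q(A) e₀ for some q, and then A e₀ =
-- p(X) e₀ = p(q(A)) e₀ because X commutes with A.  Conversely X = q(A).
-- (ii): the n + 1 polynomials λ, 1, p, …, pⁿ⁻¹ are linearly dependent modulo h,
-- and the coefficient of λ is nonzero, so λ ≡ q(p(λ)) modulo h.  Conversely
-- there is h₀ ≠ 0 of degree at most n with h₀(q(λ)) ≡ 0 modulo f, and
-- h = gcd(h₀, f(p(λ))) has degree n.
-- (iii): ℚ(μ) = ℚ[μ], so γ = q(μ).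

open import Algebra.Apartness.Bundles using (HeytingCommutativeRing; HeytingField)
open import Algebra.Bundles using (AbelianGroup; CommutativeRing; Ring; Semiring)
open import Algebra.Bundles.Raw using (RawRing)
open import Algebra.Definitions.RawMagma using (_,_)
import Algebra.Definitions.RawSemiring as RawSemiringDefinitions
import Algebra.Morphism.RingMonomorphism as RingMonomorphism
open import Algebra.Morphism.Structures using (IsRingHomomorphism; IsRingMonomorphism)
import Algebra.Properties.AbelianGroup as AbelianGroupProperties
import Algebra.Properties.CommutativeSemigroup as CommutativeSemigroupProperties
import Algebra.Properties.Ring as RingProperties
import Algebra.Properties.Semiring.Divisibility as SemiringDivisibility
import Algebra.Properties.Semiring.Sum as SemiringSum
import Algebra.Solver.Ring.NaturalCoefficients.Default as RingSolver
open import Data.Empty using (⊥-elim)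
open import Data.Fin.Base using (Fin; zero; suc; toℕ; fromℕ<; punchIn)
open import Data.Fin.Properties using (_≟_; punchInᵢ≢i; toℕ-fromℕ<)
open import Data.List.Base using ([]; _∷_; map; tabulate)
open import Data.Nat.Base as ℕ using (ℕ; zero; suc; _<_; _≤_; s≤s; z≤n)
import Data.Nat.Properties as ℕ
open import Data.Product.Base using (_,_; _×_; ∃-syntax)
open import Data.Rational.Base as ℚ using (0ℚ; 1ℚ; +-*-rawRing)
import Data.Rational.Properties as ℚ
open import Data.Sum.Base as Sum using (_⊎_; inj₁; inj₂)
open import Data.Vec.Functional as Vector using (Vector; insertAt; removeAt)
open import Data.Vec.Functional.Properties using (insertAt-lookup; insertAt-punchIn)
open import Function.Base using (_∘_)
open import Function.Bundles using (_⇔_; mk⇔)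
open import Level using (Level; 0ℓ; _⊔_) renaming (suc to lsuc)
open import Relation.Binary.Definitions using (tri<; tri≈; tri>)
open import Relation.Binary.PropositionalEquality as ≡ using (_≡_; _≢_)
import Relation.Binary.Reasoning.Setoid as SetoidReasoning
open import Relation.Nullary.Decidable.Core using (yes; no)
open import Relation.Nullary.Negation.Core using (¬_; contradiction)
open import Relation.Unary using (Pred; _∈_)

open import Defs hiding (_∣_; Irreducible)

-- Irreducibility of f enters only as a dichotomy computed by Euclid's algorithm: f divides g, or u
-- f + v g = 1. No case distinction is ever made on membership in an ideal, so an ideal may be given
-- by equations between matrices or between elements of the closure. The determinant is expanded
-- along the first row, and the cofactors of that row give only f(A) e₀ = 0. This already determines
-- the annihilator of e₀, hence makes e₀ cyclic, and cyclicity then spreads f(A) = 0 to the other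
-- columns. Behind (ii) lies the substitution g ↦ g(p(λ)), which embeds the field K[λ]/(f) into
-- K[λ]/(h). Both have dimension n, so the embedding is onto, and a preimage of λ is the required q.
-- In the other direction, h has degree at most n as a divisor of h₀, and at least n because a
-- nonzero r with r(p) ≡ 0 modulo h satisfies r ≡ r(p(q)) ≡ 0 modulo f.

-- The commutative ring of polynomials.

module PolynomialRing {c ℓ} (R : CommutativeRing c ℓ) where
  open CommutativeRing R
  open Polynomial rawRing
  private
    module ≈ = SetoidReasoning setoid
    module Rₚ = RingProperties ring

  -- Unlike _≈ₚ_, which unfolds to a function type, this record lets Agda
  -- infer the two polynomials.
  infix 4 _≋_
  record _≋_ (p q : Poly) : Set ℓ where
    constructor coeffwise
    field at : p ≈ₚ q
  open _≋_ public

  infixr 7 _·_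
  _·_ : Carrier → Poly → Poly
  a · p = map (a *_) p

  coeff-+ : ∀ p q k → coeff (p +ₚ q) k ≈ coeff p k + coeff q k
  coeff-+ []      q       k       = sym (+-identityˡ _)
  coeff-+ (a ∷ p) []      k       = sym (+-identityʳ _)
  coeff-+ (a ∷ p) (b ∷ q) zero    = refl
  coeff-+ (a ∷ p) (b ∷ q) (suc k) = coeff-+ p q k

  coeff-· : ∀ a p k → coeff (a · p) k ≈ a * coeff p k
  coeff-· a []      k       = sym (zeroʳ a)
  coeff-· a (b ∷ p) zero    = refl
  coeff-· a (b ∷ p) (suc k) = coeff-· a p k

  coeff-neg : ∀ p k → coeff (-ₚ p) k ≈ - coeff p k
  coeff-neg []      k       = sym Rₚ.-0#≈0#
  coeff-neg (b ∷ p) zero    = refl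
  coeff-neg (b ∷ p) (suc k) = coeff-neg p k

  ≋-refl : ∀ {p} → p ≋ p
  ≋-refl = coeffwise λ _ → refl

  ≋-sym : ∀ {p q} → p ≋ q → q ≋ p
  ≋-sym e = coeffwise λ k → sym (at e k)

  ≋-trans : ∀ {p q r} → p ≋ q → q ≋ r → p ≋ r
  ≋-trans e f = coeffwise λ k → trans (at e k) (at f k)

  ∷-cong : ∀ {a b p q} → a ≈ b → p ≋ q → a ∷ p ≋ b ∷ q
  ∷-cong a≈b e = coeffwise λ { zero → a≈b ; (suc k) → at e k }

  ∷-zero : ∀ {a p} → a ≈ 0# → p ≋ [] → a ∷ p ≋ []
  ∷-zero a≈0 e = coeffwise λ { zero → a≈0 ; (suc k) → at e k }

  ∷-tail : ∀ {a b p q} → a ∷ p ≋ b ∷ q → p ≋ q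
  ∷-tail e = coeffwise λ k → at e (suc k)

  ∷-zero-tail : ∀ {a p} → a ∷ p ≋ [] → p ≋ []
  ∷-zero-tail e = coeffwise λ k → at e (suc k)

  +ₚ-cong : ∀ {p p′ q q′} → p ≋ p′ → q ≋ q′ → p +ₚ q ≋ p′ +ₚ q′
  +ₚ-cong {p} {p′} {q} {q′} e f = coeffwise λ k →
    trans (coeff-+ p q k) (trans (+-cong (at e k) (at f k)) (sym (coeff-+ p′ q′ k)))

  +ₚ-assoc : ∀ p q r → (p +ₚ q) +ₚ r ≋ p +ₚ (q +ₚ r)
  +ₚ-assoc p q r = coeffwise λ k → ≈.begin
    coeff ((p +ₚ q) +ₚ r) k               ≈.≈⟨ coeff-+ (p +ₚ q) r k ⟩
    coeff (p +ₚ q) k + coeff r k          ≈.≈⟨ +-congʳ (coeff-+ p q k) ⟩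
    coeff p k + coeff q k + coeff r k     ≈.≈⟨ +-assoc _ _ _ ⟩
    coeff p k + (coeff q k + coeff r k)   ≈.≈⟨ +-congˡ (coeff-+ q r k) ⟨
    coeff p k + coeff (q +ₚ r) k          ≈.≈⟨ coeff-+ p (q +ₚ r) k ⟨
    coeff (p +ₚ (q +ₚ r)) k               ≈.∎

  +ₚ-comm : ∀ p q → p +ₚ q ≋ q +ₚ p
  +ₚ-comm p q = coeffwise λ k →
    trans (coeff-+ p q k) (trans (+-comm _ _) (sym (coeff-+ q p k)))

  +ₚ-identityʳ : ∀ p → p +ₚ [] ≋ p
  +ₚ-identityʳ p = +ₚ-comm p []

  -ₚ-cong : ∀ {p q} → p ≋ q → -ₚ p ≋ -ₚ q
  -ₚ-cong {p} {q} e = coeffwise λ k →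
    trans (coeff-neg p k) (trans (-‿cong (at e k)) (sym (coeff-neg q k)))

  -ₚ-inverseʳ : ∀ p → p +ₚ -ₚ p ≋ []
  -ₚ-inverseʳ p = coeffwise λ k →
    trans (coeff-+ p (-ₚ p) k) (trans (+-congˡ (coeff-neg p k)) (-‿inverseʳ _))

  -ₚ-inverseˡ : ∀ p → -ₚ p +ₚ p ≋ []
  -ₚ-inverseˡ p = ≋-trans (+ₚ-comm (-ₚ p) p) (-ₚ-inverseʳ p)

  +ₚ-abelianGroup : AbelianGroup c ℓ
  +ₚ-abelianGroup = record
    { Carrier = Poly ; _≈_ = _≋_ ; _∙_ = _+ₚ_ ; ε = [] ; _⁻¹ = -ₚ_
    ; isAbelianGroup = record
      { isGroup = record
        { isMonoid = record
          { isSemigroup = record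
            { isMagma = record
              { isEquivalence = record { refl = ≋-refl ; sym = ≋-sym ; trans = ≋-trans }
              ; ∙-cong = +ₚ-cong }
            ; assoc = +ₚ-assoc }
          ; identity = (λ _ → ≋-refl) , +ₚ-identityʳ }
        ; inverse = -ₚ-inverseˡ , -ₚ-inverseʳ
        ; ⁻¹-cong = -ₚ-cong }
      ; comm = +ₚ-comm } }

  private
    module G = AbelianGroup +ₚ-abelianGroup
    module ≋ = SetoidReasoning G.setoid
    module Gₚ = CommutativeSemigroupProperties G.commutativeSemigroup

  ·-cong : ∀ {a b p q} → a ≈ b → p ≋ q → a · p ≋ b · q
  ·-cong {a} {b} {p} {q} a≈b e = coeffwise λ k →
    trans (coeff-· a p k) (trans (*-cong a≈b (at e k)) (sym (coeff-· b q k)))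

  ·-zero : ∀ {a} p → a ≈ 0# → a · p ≋ []
  ·-zero {a} p a≈0 = coeffwise λ k →
    trans (coeff-· a p k) (trans (*-congʳ a≈0) (zeroˡ _))

  ·-identity : ∀ p → 1# · p ≋ p
  ·-identity p = coeffwise λ k → trans (coeff-· 1# p k) (*-identityˡ _)

  ·-assoc : ∀ a b p → (a * b) · p ≋ a · b · p
  ·-assoc a b p = coeffwise λ k →
    trans (coeff-· (a * b) p k) (trans (*-assoc _ _ _)
      (trans (*-congˡ (sym (coeff-· b p k))) (sym (coeff-· a (b · p) k))))

  ·-distribˡ : ∀ a p q → a · (p +ₚ q) ≋ a · p +ₚ a · q
  ·-distribˡ a p q = coeffwise λ k → ≈.begin
    coeff (a · (p +ₚ q)) k                ≈.≈⟨ coeff-· a (p +ₚ q) k ⟩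
    a * coeff (p +ₚ q) k                  ≈.≈⟨ *-congˡ (coeff-+ p q k) ⟩
    a * (coeff p k + coeff q k)           ≈.≈⟨ distribˡ _ _ _ ⟩
    a * coeff p k + a * coeff q k         ≈.≈⟨ +-cong (coeff-· a p k) (coeff-· a q k) ⟨
    coeff (a · p) k + coeff (a · q) k     ≈.≈⟨ coeff-+ (a · p) (a · q) k ⟨
    coeff (a · p +ₚ a · q) k              ≈.∎

  ·-distribʳ : ∀ p a b → (a + b) · p ≋ a · p +ₚ b · p
  ·-distribʳ p a b = coeffwise λ k → ≈.begin
    coeff ((a + b) · p) k                 ≈.≈⟨ coeff-· (a + b) p k ⟩
    (a + b) * coeff p k                   ≈.≈⟨ distribʳ _ _ _ ⟩
    a * coeff p k + b * coeff p k         ≈.≈⟨ +-cong (coeff-· a p k) (coeff-· b p k) ⟨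
    coeff (a · p) k + coeff (b · p) k     ≈.≈⟨ coeff-+ (a · p) (b · p) k ⟨
    coeff (a · p +ₚ b · p) k              ≈.∎

  *ₚ-zeroʳ : ∀ p → p *ₚ [] ≋ []
  *ₚ-zeroʳ []      = ≋-refl
  *ₚ-zeroʳ (a ∷ p) = ∷-zero refl (*ₚ-zeroʳ p)

  *ₚ-congˡ : ∀ p {q q′} → q ≋ q′ → p *ₚ q ≋ p *ₚ q′
  *ₚ-congˡ []      e = ≋-refl
  *ₚ-congˡ (a ∷ p) e = +ₚ-cong (·-cong refl e) (∷-cong refl (*ₚ-congˡ p e))

  *ₚ-∷ : ∀ p b q → p *ₚ (b ∷ q) ≋ b · p +ₚ (0# ∷ p *ₚ q)
  *ₚ-∷ []      b q = ≋-sym (∷-zero refl ≋-refl)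
  *ₚ-∷ (a ∷ p) b q = ∷-cong (+-congʳ (*-comm a b)) (≋.begin
    a · q +ₚ p *ₚ (b ∷ q)              ≋.≈⟨ +ₚ-cong ≋-refl (*ₚ-∷ p b q) ⟩
    a · q +ₚ (b · p +ₚ (0# ∷ p *ₚ q))  ≋.≈⟨ Gₚ.x∙yz≈y∙xz (a · q) (b · p) (0# ∷ p *ₚ q) ⟩
    b · p +ₚ (a · q +ₚ (0# ∷ p *ₚ q))  ≋.∎)

  *ₚ-comm : ∀ p q → p *ₚ q ≋ q *ₚ p
  *ₚ-comm []      q = ≋-sym (*ₚ-zeroʳ q)
  *ₚ-comm (a ∷ p) q = ≋.begin
    a · q +ₚ (0# ∷ p *ₚ q)  ≋.≈⟨ +ₚ-cong ≋-refl (∷-cong refl (*ₚ-comm p q)) ⟩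
    a · q +ₚ (0# ∷ q *ₚ p)  ≋.≈⟨ *ₚ-∷ q a p ⟨
    q *ₚ (a ∷ p)            ≋.∎

  *ₚ-cong : ∀ {p p′ q q′} → p ≋ p′ → q ≋ q′ → p *ₚ q ≋ p′ *ₚ q′
  *ₚ-cong {p} {p′} {q} {q′} e f = ≋.begin
    p *ₚ q    ≋.≈⟨ *ₚ-congˡ p f ⟩
    p *ₚ q′   ≋.≈⟨ *ₚ-comm p q′ ⟩
    q′ *ₚ p   ≋.≈⟨ *ₚ-congˡ q′ e ⟩
    q′ *ₚ p′  ≋.≈⟨ *ₚ-comm q′ p′ ⟩
    p′ *ₚ q′  ≋.∎

  0∷-+ : ∀ p q → 0# ∷ (p +ₚ q) ≋ (0# ∷ p) +ₚ (0# ∷ q)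
  0∷-+ p q = ∷-cong (sym (+-identityˡ 0#)) ≋-refl

  *ₚ-distribʳ : ∀ r p q → (p +ₚ q) *ₚ r ≋ p *ₚ r +ₚ q *ₚ r
  *ₚ-distribʳ r []      q       = ≋-refl
  *ₚ-distribʳ r (a ∷ p) []      = ≋-sym (+ₚ-identityʳ _)
  *ₚ-distribʳ r (a ∷ p) (b ∷ q) = ≋.begin
    (a + b) · r +ₚ (0# ∷ (p +ₚ q) *ₚ r)
      ≋.≈⟨ +ₚ-cong (·-distribʳ r a b) (∷-cong refl (*ₚ-distribʳ r p q)) ⟩
    (a · r +ₚ b · r) +ₚ (0# ∷ (p *ₚ r +ₚ q *ₚ r))
      ≋.≈⟨ +ₚ-cong ≋-refl (0∷-+ (p *ₚ r) (q *ₚ r)) ⟩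
    (a · r +ₚ b · r) +ₚ ((0# ∷ p *ₚ r) +ₚ (0# ∷ q *ₚ r))
      ≋.≈⟨ Gₚ.interchange (a · r) (b · r) (0# ∷ p *ₚ r) (0# ∷ q *ₚ r) ⟩
    (a · r +ₚ (0# ∷ p *ₚ r)) +ₚ (b · r +ₚ (0# ∷ q *ₚ r)) ≋.∎

  *ₚ-distribˡ : ∀ r p q → r *ₚ (p +ₚ q) ≋ r *ₚ p +ₚ r *ₚ q
  *ₚ-distribˡ r p q = ≋.begin
    r *ₚ (p +ₚ q)       ≋.≈⟨ *ₚ-comm r (p +ₚ q) ⟩
    (p +ₚ q) *ₚ r       ≋.≈⟨ *ₚ-distribʳ r p q ⟩
    p *ₚ r +ₚ q *ₚ r    ≋.≈⟨ +ₚ-cong (*ₚ-comm p r) (*ₚ-comm q r) ⟩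
    r *ₚ p +ₚ r *ₚ q    ≋.∎

  0∷-* : ∀ p q → (0# ∷ p) *ₚ q ≋ 0# ∷ p *ₚ q
  0∷-* p q = +ₚ-cong (·-zero q refl) ≋-refl

  ·-* : ∀ a p q → (a · p) *ₚ q ≋ a · (p *ₚ q)
  ·-* a []      q = ≋-refl
  ·-* a (b ∷ p) q = ≋.begin
    (a * b) · q +ₚ (0# ∷ (a · p) *ₚ q)
      ≋.≈⟨ +ₚ-cong (·-assoc a b q) (∷-cong (sym (zeroʳ a)) (·-* a p q)) ⟩
    a · b · q +ₚ a · (0# ∷ p *ₚ q)
      ≋.≈⟨ ·-distribˡ a (b · q) (0# ∷ p *ₚ q) ⟨
    a · (b · q +ₚ (0# ∷ p *ₚ q)) ≋.∎

  *ₚ-assoc : ∀ p q r → (p *ₚ q) *ₚ r ≋ p *ₚ (q *ₚ r)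
  *ₚ-assoc []      q r = ≋-refl
  *ₚ-assoc (a ∷ p) q r = ≋.begin
    (a · q +ₚ (0# ∷ p *ₚ q)) *ₚ r
      ≋.≈⟨ *ₚ-distribʳ r (a · q) (0# ∷ p *ₚ q) ⟩
    (a · q) *ₚ r +ₚ (0# ∷ p *ₚ q) *ₚ r
      ≋.≈⟨ +ₚ-cong (·-* a q r) (0∷-* (p *ₚ q) r) ⟩
    a · (q *ₚ r) +ₚ (0# ∷ (p *ₚ q) *ₚ r)
      ≋.≈⟨ +ₚ-cong ≋-refl (∷-cong refl (*ₚ-assoc p q r)) ⟩
    a · (q *ₚ r) +ₚ (0# ∷ p *ₚ (q *ₚ r)) ≋.∎

  const-* : ∀ a p → const a *ₚ p ≋ a · p
  const-* a p = ≋.begin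
    a · p +ₚ (0# ∷ [])  ≋.≈⟨ +ₚ-cong ≋-refl (∷-zero refl ≋-refl) ⟩
    a · p +ₚ []         ≋.≈⟨ +ₚ-identityʳ _ ⟩
    a · p               ≋.∎

  *ₚ-identityˡ : ∀ p → const 1# *ₚ p ≋ p
  *ₚ-identityˡ p = ≋-trans (const-* 1# p) (·-identity p)

  *ₚ-identityʳ : ∀ p → p *ₚ const 1# ≋ p
  *ₚ-identityʳ p = ≋-trans (*ₚ-comm p (const 1#)) (*ₚ-identityˡ p)

  indeterminate-* : ∀ p → indeterminate *ₚ p ≋ 0# ∷ p
  indeterminate-* p = ≋-trans (0∷-* (const 1#) p) (∷-cong refl (*ₚ-identityˡ p))

  polynomialRing : CommutativeRing c ℓ
  polynomialRing = record
    { Carrier = Poly ; _≈_ = _≋_ ; _+_ = _+ₚ_ ; _*_ = _*ₚ_ ; -_ = -ₚ_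
    ; 0# = [] ; 1# = const 1#
    ; isCommutativeRing = record
      { isRing = record
        { +-isAbelianGroup = G.isAbelianGroup
        ; *-cong = *ₚ-cong
        ; *-assoc = *ₚ-assoc
        ; *-identity = *ₚ-identityˡ , *ₚ-identityʳ
        ; distrib = *ₚ-distribˡ , *ₚ-distribʳ }
      ; *-comm = *ₚ-comm } }

  -- The identity map, read as a morphism between the two equalities; it carries the ring laws from
  -- `_≋_` back to `_≈ₚ_`.
  coeffwise-isRingMonomorphism :
    IsRingMonomorphism polyRing (CommutativeRing.rawRing polynomialRing) (λ p → p)
  coeffwise-isRingMonomorphism = record
    { isRingHomomorphism = record
      { isSemiringHomomorphism = record
        { isNearSemiringHomomorphism = record
          { +-isMonoidHomomorphism = record
            { isMagmaHomomorphism = record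
              { isRelHomomorphism = record { cong = coeffwise }
              ; homo = λ _ _ → ≋-refl }
            ; ε-homo = ≋-refl }
          ; *-homo = λ _ _ → ≋-refl }
        ; 1#-homo = ≋-refl }
      ; -‿homo = λ _ → ≋-refl }
    ; injective = at }

  -- Its raw ring is `polyRing` itself, so the theory of determinants applies literally to the
  -- determinant that defines `charPoly`.
  polynomialRing-≈ₚ : CommutativeRing c ℓ
  polynomialRing-≈ₚ = record
    { isCommutativeRing = RingMonomorphism.isCommutativeRing coeffwise-isRingMonomorphism
        (CommutativeRing.isCommutativeRing polynomialRing) }

-- Left ideals, evaluation of polynomials, composition.

-- Left ideals, because the matrices that kill e₀ are stable under multiplication from the left
-- only.
record IsLeftIdeal {a b j} (S : Ring a b) (J : Pred (Ring.Carrier S) j) : Set (a ⊔ b ⊔ j) where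
  open Ring S
  field
    resp     : ∀ {x y} → x ≈ y → J x → J y
    +-closed : ∀ {x y} → J x → J y → J (x + y)
    *-closed : ∀ u {x} → J x → J (u * x)

  neg-closed : ∀ {x} → J x → J (- x)
  neg-closed {x} Jx = resp (RingProperties.-1*x≈-x S x) (*-closed (- 1#) Jx)

module _ {c ℓ} (R : CommutativeRing c ℓ) where
  open CommutativeRing R
  open SemiringDivisibility semiring using (_∣_; ∣ʳ-respʳ-≈; x∣ʳy⇒x∣ʳzy)

  multiples-isLeftIdeal : ∀ d → IsLeftIdeal ring (d ∣_)
  multiples-isLeftIdeal d = record
    { resp     = ∣ʳ-respʳ-≈
    ; +-closed = λ { (p , e) (q , f) → p + q , trans (distribʳ d p q) (+-cong e f) }
    ; *-closed = λ u → x∣ʳy⇒x∣ʳzy u }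

  zero-isLeftIdeal : IsLeftIdeal ring (_≈ 0#)
  zero-isLeftIdeal = record
    { resp     = λ e x≈0 → trans (sym e) x≈0
    ; +-closed = λ x≈0 y≈0 → trans (+-cong x≈0 y≈0) (+-identityʳ 0#)
    ; *-closed = λ u x≈0 → trans (*-congˡ x≈0) (zeroʳ u) }

-- `S` may be noncommutative, to cover evaluation at a matrix; centrality of the coefficients is
-- what makes evaluation multiplicative. The other instances are the closure and, for composition,
-- the polynomial ring.
module Evaluation {c ℓ a b} (R : CommutativeRing c ℓ) (S : Ring a b)
  (ι : CommutativeRing.Carrier R → Ring.Carrier S)
  (ι-hom : IsRingHomomorphism (CommutativeRing.rawRing R) (Ring.rawRing S) ι)
  (central : ∀ r x → Ring._≈_ S (Ring._*_ S (ι r) x) (Ring._*_ S x (ι r)))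
  where

  private module R = CommutativeRing R
  open Polynomial R.rawRing using (Poly; _+ₚ_; _*ₚ_; -ₚ_; const; indeterminate)
  open PolynomialRing R
  open Ring S
  open IsRingHomomorphism ι-hom
  open RingProperties S
  open CommutativeSemigroupProperties +-commutativeSemigroup using (interchange)
  open SetoidReasoning setoid
  open SemiringSum semiring using (sum; sum-cong-≋; *-distribˡ-sum)
  open RawSemiringDefinitions (Semiring.rawSemiring semiring) using (_^_)

  ⟦_⟧ : Poly → Carrier → Carrier
  ⟦ p ⟧ x = Polynomial.eval R.rawRing rawRing ι p x

  ⟦⟧-zero : ∀ {p} x → p ≋ [] → ⟦ p ⟧ x ≈ 0#
  ⟦⟧-zero {[]}    x e = refl
  ⟦⟧-zero {r ∷ p} x e = begin
    ι r + x * ⟦ p ⟧ x  ≈⟨ +-cong (trans (⟦⟧-cong (at e 0)) 0#-homo) (*-congˡ (⟦⟧-zero x (∷-zero-tail e))) ⟩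
    0# + x * 0#        ≈⟨ +-identityˡ _ ⟩
    x * 0#             ≈⟨ zeroʳ x ⟩
    0#                 ∎

  ⟦⟧-congˡ : ∀ {p q} x → p ≋ q → ⟦ p ⟧ x ≈ ⟦ q ⟧ x
  ⟦⟧-congˡ {[]}    {q}     x e = sym (⟦⟧-zero x (≋-sym e))
  ⟦⟧-congˡ {r ∷ p} {[]}    x e = ⟦⟧-zero x e
  ⟦⟧-congˡ {r ∷ p} {s ∷ q} x e =
    +-cong (⟦⟧-cong (at e 0)) (*-congˡ (⟦⟧-congˡ x (∷-tail e)))

  ⟦⟧-congʳ : ∀ p {x y} → x ≈ y → ⟦ p ⟧ x ≈ ⟦ p ⟧ y
  ⟦⟧-congʳ []      e = refl
  ⟦⟧-congʳ (r ∷ p) e = +-congˡ (*-cong e (⟦⟧-congʳ p e))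

  ⟦⟧-+ : ∀ p q x → ⟦ p +ₚ q ⟧ x ≈ ⟦ p ⟧ x + ⟦ q ⟧ x
  ⟦⟧-+ []      q       x = sym (+-identityˡ _)
  ⟦⟧-+ (r ∷ p) []      x = sym (+-identityʳ _)
  ⟦⟧-+ (r ∷ p) (s ∷ q) x = begin
    ι (r R.+ s) + x * ⟦ p +ₚ q ⟧ x
      ≈⟨ +-cong (+-homo r s) (trans (*-congˡ (⟦⟧-+ p q x)) (distribˡ _ _ _)) ⟩
    (ι r + ι s) + (x * ⟦ p ⟧ x + x * ⟦ q ⟧ x)
      ≈⟨ interchange _ _ _ _ ⟩
    (ι r + x * ⟦ p ⟧ x) + (ι s + x * ⟦ q ⟧ x) ∎

  ⟦⟧-neg : ∀ p x → ⟦ -ₚ p ⟧ x ≈ - ⟦ p ⟧ x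
  ⟦⟧-neg []      x = sym -0#≈0#
  ⟦⟧-neg (r ∷ p) x = begin
    ι (R.- r) + x * ⟦ -ₚ p ⟧ x  ≈⟨ +-cong (-‿homo r) (*-congˡ (⟦⟧-neg p x)) ⟩
    - ι r + x * - ⟦ p ⟧ x       ≈⟨ +-congˡ (-‿distribʳ-* _ _) ⟨
    - ι r + - (x * ⟦ p ⟧ x)     ≈⟨ -‿+-comm _ _ ⟩
    - (ι r + x * ⟦ p ⟧ x)       ∎

  ⟦⟧-· : ∀ r p x → ⟦ r · p ⟧ x ≈ ι r * ⟦ p ⟧ x
  ⟦⟧-· r []      x = sym (zeroʳ _)
  ⟦⟧-· r (s ∷ p) x = begin
    ι (r R.* s) + x * ⟦ r · p ⟧ x      ≈⟨ +-cong (*-homo r s) (*-congˡ (⟦⟧-· r p x)) ⟩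
    ι r * ι s + x * (ι r * ⟦ p ⟧ x)    ≈⟨ +-congˡ (*-assoc _ _ _) ⟨
    ι r * ι s + (x * ι r) * ⟦ p ⟧ x    ≈⟨ +-congˡ (*-congʳ (central r x)) ⟨
    ι r * ι s + (ι r * x) * ⟦ p ⟧ x    ≈⟨ +-congˡ (*-assoc _ _ _) ⟩
    ι r * ι s + ι r * (x * ⟦ p ⟧ x)    ≈⟨ distribˡ _ _ _ ⟨
    ι r * (ι s + x * ⟦ p ⟧ x)          ∎

  ⟦⟧-* : ∀ p q x → ⟦ p *ₚ q ⟧ x ≈ ⟦ p ⟧ x * ⟦ q ⟧ x
  ⟦⟧-* []      q x = sym (zeroˡ _)
  ⟦⟧-* (r ∷ p) q x = begin
    ⟦ r · q +ₚ (R.0# ∷ p *ₚ q) ⟧ x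
      ≈⟨ ⟦⟧-+ (r · q) (R.0# ∷ p *ₚ q) x ⟩
    ⟦ r · q ⟧ x + (ι R.0# + x * ⟦ p *ₚ q ⟧ x)
      ≈⟨ +-cong (⟦⟧-· r q x) (+-cong 0#-homo (*-congˡ (⟦⟧-* p q x))) ⟩
    ι r * ⟦ q ⟧ x + (0# + x * (⟦ p ⟧ x * ⟦ q ⟧ x))
      ≈⟨ +-congˡ (trans (+-identityˡ _) (sym (*-assoc _ _ _))) ⟩
    ι r * ⟦ q ⟧ x + (x * ⟦ p ⟧ x) * ⟦ q ⟧ x
      ≈⟨ distribʳ _ _ _ ⟨
    (ι r + x * ⟦ p ⟧ x) * ⟦ q ⟧ x ∎

  ⟦⟧-const : ∀ r x → ⟦ const r ⟧ x ≈ ι r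
  ⟦⟧-const r x = trans (+-congˡ (zeroʳ x)) (+-identityʳ _)

  ⟦⟧-1 : ∀ x → ⟦ const R.1# ⟧ x ≈ 1#
  ⟦⟧-1 x = trans (⟦⟧-const R.1# x) 1#-homo

  ⟦⟧-indeterminate : ∀ x → ⟦ indeterminate ⟧ x ≈ x
  ⟦⟧-indeterminate x = begin
    ι R.0# + x * ⟦ const R.1# ⟧ x  ≈⟨ +-cong 0#-homo (*-congˡ (⟦⟧-1 x)) ⟩
    0# + x * 1#                    ≈⟨ +-identityˡ _ ⟩
    x * 1#                         ≈⟨ *-identityʳ x ⟩
    x                              ∎

  -- For matrices this is applied twice: X commutes with p(X), and whatever commutes with A commutes
  -- with every polynomial in A.
  ⟦⟧-commutes : ∀ p {x y} → y * x ≈ x * y → y * ⟦ p ⟧ x ≈ ⟦ p ⟧ x * y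
  ⟦⟧-commutes []      {x} {y} e = trans (zeroʳ y) (sym (zeroˡ y))
  ⟦⟧-commutes (r ∷ p) {x} {y} e = begin
    y * (ι r + x * ⟦ p ⟧ x)        ≈⟨ distribˡ _ _ _ ⟩
    y * ι r + y * (x * ⟦ p ⟧ x)    ≈⟨ +-cong (sym (central r y)) (sym (*-assoc _ _ _)) ⟩
    ι r * y + (y * x) * ⟦ p ⟧ x    ≈⟨ +-congˡ (*-congʳ e) ⟩
    ι r * y + (x * y) * ⟦ p ⟧ x    ≈⟨ +-congˡ (*-assoc _ _ _) ⟩
    ι r * y + x * (y * ⟦ p ⟧ x)    ≈⟨ +-congˡ (*-congˡ (⟦⟧-commutes p e)) ⟩
    ι r * y + x * (⟦ p ⟧ x * y)    ≈⟨ +-congˡ (*-assoc _ _ _) ⟨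
    ι r * y + (x * ⟦ p ⟧ x) * y    ≈⟨ distribʳ _ _ _ ⟨
    (ι r + x * ⟦ p ⟧ x) * y        ∎

  ⟦⟧-tabulate : ∀ {n} (t : Fin n → R.Carrier) x →
                ⟦ tabulate t ⟧ x ≈ sum (λ i → ι (t i) * x ^ toℕ i)
  ⟦⟧-tabulate {zero}  t x = refl
  ⟦⟧-tabulate {suc n} t x = +-cong (sym (*-identityʳ _)) (begin
    x * ⟦ tabulate (λ i → t (suc i)) ⟧ x
      ≈⟨ *-congˡ (⟦⟧-tabulate (λ i → t (suc i)) x) ⟩
    x * sum (λ i → ι (t (suc i)) * x ^ toℕ i)
      ≈⟨ *-distribˡ-sum x (λ i → ι (t (suc i)) * x ^ toℕ i) ⟩
    sum (λ i → x * (ι (t (suc i)) * x ^ toℕ i))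
      ≈⟨ sum-cong-≋ {n} (λ i → trans (sym (*-assoc _ _ _))
           (trans (*-congʳ (sym (central (t (suc i)) x))) (*-assoc _ _ _))) ⟩
    sum (λ i → ι (t (suc i)) * (x * x ^ toℕ i)) ∎)

  -- Evaluation at `x` is a ring homomorphism. Every ideal to which `irreducible-generates` is
  -- applied arises in this way.
  preimage-isLeftIdeal : ∀ {j} {J : Pred Carrier j} → IsLeftIdeal S J → ∀ x →
    IsLeftIdeal (CommutativeRing.ring polynomialRing) (λ f → J (⟦ f ⟧ x))
  preimage-isLeftIdeal isIdeal x = record
    { resp     = λ e → resp (⟦⟧-congˡ x e)
    ; +-closed = λ {f} {g} Jf Jg → resp (sym (⟦⟧-+ f g x)) (+-closed Jf Jg)
    ; *-closed = λ u {f} Jf → resp (sym (⟦⟧-* u f x)) (*-closed (⟦ u ⟧ x) Jf) }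
    where open IsLeftIdeal isIdeal

module Composition {c ℓ} (R : CommutativeRing c ℓ) where
  open CommutativeRing R
  open Polynomial rawRing using (const; indeterminate)
  open PolynomialRing R
  private module P = CommutativeRing polynomialRing

  const-isRingHomomorphism : IsRingHomomorphism rawRing P.rawRing const
  const-isRingHomomorphism = record
    { isSemiringHomomorphism = record
      { isNearSemiringHomomorphism = record
        { +-isMonoidHomomorphism = record
          { isMagmaHomomorphism = record
            { isRelHomomorphism = record { cong = λ e → ∷-cong e ≋-refl }
            ; homo = λ _ _ → ≋-refl }
          ; ε-homo = ∷-zero refl ≋-refl }
        ; *-homo = λ _ _ → ∷-cong (sym (+-identityʳ _)) ≋-refl }
      ; 1#-homo = ≋-refl }
    ; -‿homo = λ _ → ≋-refl }

  open Evaluation R P.ring const const-isRingHomomorphism (λ r p → P.*-comm (const r) p) public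
    renaming
    ( ⟦_⟧ to comp ; ⟦⟧-+ to comp-+
    ; ⟦⟧-neg to comp-neg ; ⟦⟧-· to comp-· ; ⟦⟧-1 to comp-1
    ; ⟦⟧-indeterminate to comp-indeterminateˡ ; ⟦⟧-tabulate to comp-tabulate
    ; preimage-isLeftIdeal to comp-isLeftIdeal )
    using ()

  comp-indeterminateʳ : ∀ p → comp p indeterminate ≋ p
  comp-indeterminateʳ []      = ≋-refl
  comp-indeterminateʳ (a ∷ p) = begin
    const a P.+ indeterminate P.* comp p indeterminate
      ≈⟨ P.+-congˡ {const a} (P.*-congˡ {indeterminate} (comp-indeterminateʳ p)) ⟩
    const a P.+ indeterminate P.* p
      ≈⟨ P.+-congˡ {const a} (indeterminate-* p) ⟩
    (a + 0#) ∷ p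
      ≈⟨ ∷-cong (+-identityʳ a) ≋-refl ⟩
    a ∷ p ∎
    where open SetoidReasoning P.setoid

module EvaluateComposition {c ℓ a b} (R : CommutativeRing c ℓ) (S : Ring a b)
  (ι : CommutativeRing.Carrier R → Ring.Carrier S)
  (ι-hom : IsRingHomomorphism (CommutativeRing.rawRing R) (Ring.rawRing S) ι)
  (central : ∀ r x → Ring._≈_ S (Ring._*_ S (ι r) x) (Ring._*_ S x (ι r)))
  where

  open Polynomial (CommutativeRing.rawRing R) using (_*ₚ_; const)
  open Ring S
  open Composition R using (comp)
  open Evaluation R S ι ι-hom central
  open SetoidReasoning setoid

  ⟦⟧-comp : ∀ f p x → ⟦ comp f p ⟧ x ≈ ⟦ f ⟧ (⟦ p ⟧ x)
  ⟦⟧-comp []      p x = refl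
  ⟦⟧-comp (r ∷ f) p x = begin
    ⟦ comp (r ∷ f) p ⟧ x
      ≈⟨ ⟦⟧-+ (const r) (p *ₚ comp f p) x ⟩
    ⟦ const r ⟧ x + ⟦ p *ₚ comp f p ⟧ x
      ≈⟨ +-cong (⟦⟧-const r x) (⟦⟧-* p (comp f p) x) ⟩
    ι r + ⟦ p ⟧ x * ⟦ comp f p ⟧ x
      ≈⟨ +-congˡ (*-congˡ (⟦⟧-comp f p x)) ⟩
    ι r + ⟦ p ⟧ x * ⟦ f ⟧ (⟦ p ⟧ x) ∎

-- Determinants: repeated rows and the cofactors of the first row.

module Determinant {c ℓ} (R : CommutativeRing c ℓ) where
  open CommutativeRing R hiding (zero)
  open Matrices rawRing using (Matrix; det)
  open SemiringSum semiring using (sum; sum-syntax; sum-cong-≋; *-distribˡ-sum; ∑-distrib-+; sum-replicate-zero)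
  open RawSemiringDefinitions (Semiring.rawSemiring semiring) using (_^_)
  open RingSolver commutativeSemiring using (solve; _:+_; _:*_; _:=_)
  open SetoidReasoning setoid

  sum-zero : ∀ {n} {v : Vector Carrier n} → (∀ i → v i ≈ 0#) → sum v ≈ 0#
  sum-zero {n} v≈0 = trans (sum-cong-≋ v≈0) (sum-replicate-zero n)

  private
    ε : Carrier
    ε = - 1#

  -- The only place where the value -1 of `ε` matters. Elsewhere it is an atom, so that
  -- rearrangements can be left to the semiring solver.
  ε-cancel : ∀ x y z → y ≈ 0# → (x + ε * x) + z * y ≈ 0#
  ε-cancel x y z y≈0 = begin
    (x + ε * x) + z * y       ≈⟨ +-cong (+-congʳ (sym (*-identityˡ x))) (*-congˡ y≈0) ⟩
    (1# * x + ε * x) + z * 0# ≈⟨ +-cong (sym (distribʳ x 1# ε)) (zeroʳ z) ⟩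
    (1# + ε) * x + 0#         ≈⟨ +-identityʳ _ ⟩
    (1# + ε) * x              ≈⟨ *-congʳ (-‿inverseʳ 1#) ⟩
    0# * x                    ≈⟨ zeroˡ x ⟩
    0#                        ∎

  -- With the minors as φ this is by definition the expansion of `det`. Leaving φ arbitrary
  -- separates the signs from the recursion.
  alternating : ∀ {n} → Vector Carrier n → Vector Carrier n → Carrier
  alternating a φ = sum (λ j → (ε ^ toℕ j) * (a j * φ j))

  alternating-cong : ∀ {n} {a b φ χ : Vector Carrier n} →
    (∀ j → a j ≈ b j) → (∀ j → φ j ≈ χ j) → alternating a φ ≈ alternating b χ
  alternating-cong a≈b φ≈χ = sum-cong-≋ λ j → *-congˡ (*-cong (a≈b j) (φ≈χ j))

  alternating-zero : ∀ {n} (a φ : Vector Carrier n) → (∀ j → φ j ≈ 0#) → alternating a φ ≈ 0#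
  alternating-zero a φ φ≈0 = sum-zero λ j →
    trans (*-congˡ (trans (*-congˡ (φ≈0 j)) (zeroʳ _))) (zeroʳ _)

  alternating-suc : ∀ {n} (a φ : Vector Carrier (suc n)) →
    alternating a φ ≈ a zero * φ zero + ε * alternating (Vector.tail a) (Vector.tail φ)
  alternating-suc {n} a φ = +-cong (*-identityˡ _) (begin
    ∑[ j < n ] ((ε * ε ^ toℕ j) * (a (suc j) * φ (suc j)))
      ≈⟨ sum-cong-≋ {n} (λ j → *-assoc ε (ε ^ toℕ j) (a (suc j) * φ (suc j))) ⟩
    ∑[ j < n ] (ε * (ε ^ toℕ j * (a (suc j) * φ (suc j))))
      ≈⟨ *-distribˡ-sum {n} ε (λ j → ε ^ toℕ j * (a (suc j) * φ (suc j))) ⟨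
    ε * alternating (Vector.tail a) (Vector.tail φ) ∎)

  alternating-linear : ∀ {n} (a φ χ : Vector Carrier n) x y →
    alternating a (λ j → x * φ j + y * χ j) ≈ x * alternating a φ + y * alternating a χ
  alternating-linear {n} a φ χ x y = begin
    ∑[ j < n ] (ε ^ toℕ j * (a j * (x * φ j + y * χ j)))
      ≈⟨ sum-cong-≋ {n} (λ j → solve 6 (λ e a φ χ x y →
           e :* (a :* (x :* φ :+ y :* χ)) := x :* (e :* (a :* φ)) :+ y :* (e :* (a :* χ)))
           refl (ε ^ toℕ j) (a j) (φ j) (χ j) x y) ⟩
    ∑[ j < n ] (x * (ε ^ toℕ j * (a j * φ j)) + y * (ε ^ toℕ j * (a j * χ j)))
      ≈⟨ ∑-distrib-+ {n} (λ j → x * (ε ^ toℕ j * (a j * φ j))) (λ j → y * (ε ^ toℕ j * (a j * χ j))) ⟩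
    ∑[ j < n ] (x * (ε ^ toℕ j * (a j * φ j))) + ∑[ j < n ] (y * (ε ^ toℕ j * (a j * χ j)))
      ≈⟨ +-cong (*-distribˡ-sum {n} x (λ j → ε ^ toℕ j * (a j * φ j))) (*-distribˡ-sum {n} y (λ j → ε ^ toℕ j * (a j * χ j))) ⟨
    x * alternating a φ + y * alternating a χ ∎

  det-cong : ∀ {n} {A B : Matrix n} → (∀ i j → A i j ≈ B i j) → det A ≈ det B
  det-cong {zero}  A≈B = refl
  det-cong {suc n} A≈B = alternating-cong (A≈B zero) λ j → det-cong λ i k → A≈B (suc i) (punchIn j k)

  -- The expansion of a determinant along its first two rows a and b, with an
  -- arbitrary function ψ of the columns of the remaining rows in place of the
  -- smaller determinant.
  module _ {ξ} {X : Set ξ} where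

    double : ∀ {n} (a b : Vector Carrier (suc (suc n))) → Vector X (suc (suc n)) →
             (Vector X n → Carrier) → Carrier
    double a b C ψ = alternating a λ j → alternating (removeAt b j) λ k →
      ψ (removeAt (removeAt C j) k)

    -- Columns removed in different orders give vectors that agree only pointwise, so ψ has to
    -- respect pointwise equality.
    Extensional : ∀ {n} → (Vector X n → Carrier) → Set _
    Extensional ψ = ∀ {C D} → (∀ k → C k ≡ D k) → ψ C ≈ ψ D

    ∷-ext : ∀ {n} {ψ : Vector X (suc n) → Carrier} x → Extensional ψ →
            Extensional (λ C → ψ (x Vector.∷ C))
    ∷-ext x ψ-ext C≗D = ψ-ext λ { zero → ≡.refl ; (suc k) → C≗D k }

    -- The terms in which neither row uses the first column: both expansions run over the tails, and
    -- the first column is handed to ψ untouched. With only two columns there are no such terms.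
    double-tail : ∀ {n} (a b : Vector Carrier (suc (suc n))) → Vector X (suc (suc n)) →
             (Vector X n → Carrier) → Carrier
    double-tail {zero}  a b C ψ = 0#
    double-tail {suc n} a b C ψ =
      double (Vector.tail a) (Vector.tail b) (Vector.tail C) (λ D → ψ (C zero Vector.∷ D))

    -- The terms are sorted by who uses the first column: row `a`, row `b`, or neither. In the first
    -- two cases the other row expands over the same tail with the same φ, and this symmetry in `a`
    -- and `b` drives everything below.
    double-suc : ∀ {n} (a b : Vector Carrier (suc (suc n))) (C : Vector X (suc (suc n)))
      (ψ : Vector X n → Carrier) → Extensional ψ →
      let φ = λ j → ψ (removeAt (Vector.tail C) j) in
      double a b C ψ ≈ a zero * alternating (Vector.tail b) φ
        + ε * (b zero * alternating (Vector.tail a) φ + ε * double-tail a b C ψ)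
    double-suc {n} a b C ψ ψ-ext = begin
      double a b C ψ
        ≈⟨ alternating-suc a (λ j → alternating (removeAt b j) λ k → ψ (removeAt (removeAt C j) k)) ⟩
      a zero * alternating (Vector.tail b) φ + ε * alternating (Vector.tail a) χ
        ≈⟨ +-congˡ (*-congˡ (inner a b C ψ ψ-ext)) ⟩
      a zero * alternating (Vector.tail b) φ
        + ε * (b zero * alternating (Vector.tail a) φ + ε * double-tail a b C ψ) ∎
      where
      φ = λ j → ψ (removeAt (Vector.tail C) j)
      χ = λ j → alternating (removeAt b (suc j)) λ k → ψ (removeAt (removeAt C (suc j)) k)

      inner : ∀ {n} (a b : Vector Carrier (suc (suc n))) (C : Vector X (suc (suc n)))
        (ψ : Vector X n → Carrier) → Extensional ψ →
        alternating (Vector.tail a) (λ j → alternating (removeAt b (suc j)) λ k →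
          ψ (removeAt (removeAt C (suc j)) k))
        ≈ b zero * alternating (Vector.tail a) (λ j → ψ (removeAt (Vector.tail C) j))
          + ε * double-tail a b C ψ
      inner {n} a b C ψ ψ-ext = begin
        alternating (Vector.tail a) (λ j → alternating (removeAt b (suc j)) λ k →
            ψ (removeAt (removeAt C (suc j)) k))
          ≈⟨ alternating-cong {a = Vector.tail a} (λ _ → refl) (λ j → alternating-suc (removeAt b (suc j))
               (λ k → ψ (removeAt (removeAt C (suc j)) k))) ⟩
        alternating (Vector.tail a) (λ j → b zero * ψ (removeAt (Vector.tail C) j)
            + ε * rest j)
          ≈⟨ alternating-linear (Vector.tail a) (λ j → ψ (removeAt (Vector.tail C) j)) rest (b zero) ε ⟩
        b zero * alternating (Vector.tail a) (λ j → ψ (removeAt (Vector.tail C) j))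
            + ε * alternating (Vector.tail a) rest
          ≈⟨ +-congˡ (*-congˡ (rest≈ n a b C ψ ψ-ext)) ⟩
        b zero * alternating (Vector.tail a) (λ j → ψ (removeAt (Vector.tail C) j))
            + ε * double-tail a b C ψ ∎
        where
        rest = λ j → alternating (Vector.tail (removeAt b (suc j)))
                       (λ k → ψ (removeAt (removeAt C (suc j)) (suc k)))

        rest≈ : ∀ n (a b : Vector Carrier (suc (suc n))) (C : Vector X (suc (suc n)))
          (ψ : Vector X n → Carrier) → Extensional ψ →
          alternating (Vector.tail a) (λ j → alternating (Vector.tail (removeAt b (suc j)))
            (λ k → ψ (removeAt (removeAt C (suc j)) (suc k)))) ≈ double-tail a b C ψ
        rest≈ zero    a b C ψ ψ-ext = alternating-zero (Vector.tail a) (λ _ → 0#) (λ _ → refl)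
        rest≈ (suc n) a b C ψ ψ-ext =
          alternating-cong {a = Vector.tail a} (λ _ → refl) λ j →
          alternating-cong {a = Vector.tail (removeAt b (suc j))} (λ _ → refl) λ k →
          ψ-ext {removeAt (removeAt C (suc j)) (suc k)}
                {C zero Vector.∷ removeAt (removeAt (Vector.tail C) j) k}
                λ { zero → ≡.refl ; (suc m) → ≡.refl }

    -- Exchanging `a` and `b` exchanges x and y in `double-suc`, so the sum is (1 + ε)(x + y) + ε²
    -- (d + d′). The first summand vanishes, the second does so by induction on the number of
    -- columns.
    double-antisym : ∀ {n} (a b : Vector Carrier (suc (suc n))) (C : Vector X (suc (suc n)))
      (ψ : Vector X n → Carrier) → Extensional ψ → double a b C ψ + double b a C ψ ≈ 0#
    double-antisym {n} a b C ψ ψ-ext = begin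
      double a b C ψ + double b a C ψ
        ≈⟨ +-cong (double-suc a b C ψ ψ-ext) (double-suc b a C ψ ψ-ext) ⟩
      (x + ε * (y + ε * d)) + (y + ε * (x + ε * d′))
        ≈⟨ solve 5 (λ e x y d d′ → (x :+ e :* (y :+ e :* d)) :+ (y :+ e :* (x :+ e :* d′))
             := ((x :+ y) :+ e :* (x :+ y)) :+ (e :* e) :* (d :+ d′)) refl ε x y d d′ ⟩
      ((x + y) + ε * (x + y)) + (ε * ε) * (d + d′)
        ≈⟨ ε-cancel (x + y) (d + d′) (ε * ε) (tails n a b C ψ ψ-ext) ⟩
      0# ∎
      where
      x = a zero * alternating (Vector.tail b) (λ j → ψ (removeAt (Vector.tail C) j))
      y = b zero * alternating (Vector.tail a) (λ j → ψ (removeAt (Vector.tail C) j))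
      d = double-tail a b C ψ
      d′ = double-tail b a C ψ

      tails : ∀ n (a b : Vector Carrier (suc (suc n))) (C : Vector X (suc (suc n)))
        (ψ : Vector X n → Carrier) → Extensional ψ →
        double-tail a b C ψ + double-tail b a C ψ ≈ 0#
      tails zero    a b C ψ ψ-ext = +-identityʳ 0#
      tails (suc n) a b C ψ ψ-ext = double-antisym (Vector.tail a) (Vector.tail b) (Vector.tail C)
        (λ D → ψ (C zero Vector.∷ D)) (∷-ext (C zero) ψ-ext)

    -- Antisymmetry would give only twice the value as 0, and 2 need not be cancellable in `R`;
    -- hence a separate induction of the same shape.
    double-alternating : ∀ {n} (a : Vector Carrier (suc (suc n))) (C : Vector X (suc (suc n)))
      (ψ : Vector X n → Carrier) → Extensional ψ → double a a C ψ ≈ 0#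
    double-alternating {n} a C ψ ψ-ext = begin
      double a a C ψ
        ≈⟨ double-suc a a C ψ ψ-ext ⟩
      x + ε * (x + ε * d)
        ≈⟨ solve 3 (λ e x d → x :+ e :* (x :+ e :* d) := (x :+ e :* x) :+ (e :* e) :* d) refl ε x d ⟩
      (x + ε * x) + (ε * ε) * d
        ≈⟨ ε-cancel x d (ε * ε) (tail n a C ψ ψ-ext) ⟩
      0# ∎
      where
      x = a zero * alternating (Vector.tail a) (λ j → ψ (removeAt (Vector.tail C) j))
      d = double-tail a a C ψ

      tail : ∀ n (a : Vector Carrier (suc (suc n))) (C : Vector X (suc (suc n)))
        (ψ : Vector X n → Carrier) → Extensional ψ → double-tail a a C ψ ≈ 0#
      tail zero    a C ψ ψ-ext = refl
      tail (suc n) a C ψ ψ-ext = double-alternating (Vector.tail a) (Vector.tail C)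
        (λ D → ψ (C zero Vector.∷ D)) (∷-ext (C zero) ψ-ext)

  columns : ∀ {m n} → Vector (Vector Carrier n) m → Vector (Vector Carrier m) n
  columns = Vector.transpose

  det-columns-ext : ∀ {n} → Extensional {X = Vector Carrier n} (λ C → det (columns C))
  det-columns-ext C≗D = det-cong λ i j → reflexive (≡.cong (λ f → f i) (C≗D j))

  -- If the two rows are adjacent, `double-alternating` applies. Otherwise the first two rows are
  -- swapped at the cost of a sign; every minor along the new first row then begins with the old
  -- first row, which is repeated further down.
  det-repeated-row : ∀ {n} (A : Matrix (suc n)) i → (∀ j → A zero j ≈ A (suc i) j) → det A ≈ 0#
  det-repeated-row {suc n} A zero same = begin
    det A
      ≈⟨ det-cong {A = A} {B = B} (λ { zero j → refl ; (suc zero) j → sym (same j) ; (suc (suc i)) j → refl }) ⟩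
    double (A zero) (A zero) (columns (λ i → A (suc (suc i)))) (λ C → det (columns C))
      ≈⟨ double-alternating (A zero) (columns (λ i → A (suc (suc i)))) (λ C → det (columns C)) det-columns-ext ⟩
    0# ∎
    where
    B : Matrix (suc (suc n))
    B = A zero Vector.∷ A zero Vector.∷ λ i → A (suc (suc i))
  det-repeated-row {suc n} A (suc i) same = begin
    det A                ≈⟨ +-identityʳ _ ⟨
    det A + 0#           ≈⟨ +-congˡ swapped ⟨
    det A + double (A (suc zero)) (A zero) C (λ C → det (columns C))
      ≈⟨ double-antisym (A zero) (A (suc zero)) C (λ C → det (columns C)) det-columns-ext ⟩
    0# ∎
    where
    C = columns (λ i → A (suc (suc i)))
    swapped : double (A (suc zero)) (A zero) C (λ C → det (columns C)) ≈ 0#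
    swapped = alternating-zero (A (suc zero))
      (λ j → alternating (removeAt (A zero) j) λ k → det (columns (removeAt (removeAt C j) k)))
      (λ j → det-repeated-row (removeAt (A zero) j Vector.∷ λ i → removeAt (A (suc (suc i))) j) i (λ k → same _))

  cofactor : ∀ {n} → Matrix (suc n) → Vector Carrier (suc n)
  cofactor A j = ε ^ toℕ j * det (λ i → removeAt (A (suc i)) j)

  private
    cofactor-sum : ∀ {n} (A : Matrix (suc n)) (a : Vector Carrier (suc n)) →
      ∑[ j < suc n ] (cofactor A j * a j) ≈ det (a Vector.∷ λ i → A (suc i))
    cofactor-sum {n} A a = sum-cong-≋ {suc n} λ j → solve 3 (λ e d a → (e :* d) :* a := e :* (a :* d)) refl
      (ε ^ toℕ j) (det (λ i → removeAt (A (suc i)) j)) (a j)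

  cofactor-zero : ∀ {n} (A : Matrix (suc n)) → ∑[ j < suc n ] (cofactor A j * A zero j) ≈ det A
  cofactor-zero A = cofactor-sum A (A zero)

  -- This is the determinant of `A` with its first row replaced by a copy of a lower row.
  cofactor-suc : ∀ {n} (A : Matrix (suc n)) i → ∑[ j < suc n ] (cofactor A j * A (suc i) j) ≈ 0#
  cofactor-suc A i = trans (cofactor-sum A (A (suc i)))
    (det-repeated-row (A (suc i) Vector.∷ λ i → A (suc i)) i (λ _ → refl))

  det-scalar-1 : ∀ n → det {n} (Matrices.scalar rawRing 1#) ≈ 1#
  det-scalar-1 zero    = refl
  det-scalar-1 (suc n) = begin
    det {suc n} I
      ≈⟨ alternating-suc {n} (I zero) (λ j → det (λ i → removeAt (I (suc i)) j)) ⟩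
    1# * det (λ i k → I {suc n} (suc i) (suc k)) + ε * alternating (λ j → 0#) minor
      ≈⟨ +-cong (trans (*-identityˡ _) (trans (det-cong {n} {λ i k → I (suc i) (suc k)} {I} I-suc) (det-scalar-1 n)))
           (trans (*-congˡ (sum-zero λ j → trans (*-congˡ {ε ^ toℕ j} (zeroˡ (minor j))) (zeroʳ _))) (zeroʳ ε)) ⟩
    1# + 0#
      ≈⟨ +-identityʳ 1# ⟩
    1# ∎
    where
    I : ∀ {n} → Matrix n
    I = Matrices.scalar rawRing 1#

    I-suc : ∀ i k → I {suc n} (suc i) (suc k) ≈ I i k
    I-suc i k with i ≟ k
    ... | yes _ = refl
    ... | no _  = refl

    minor : Vector Carrier n
    minor j = det (λ i → removeAt (I {suc n} (suc i)) (suc j))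

-- Degrees, and the leading coefficient of the characteristic polynomial.

module Degree {c ℓ} (R : CommutativeRing c ℓ) where
  open CommutativeRing R hiding (zero)
  open Polynomial rawRing using (Poly; coeff; _*ₚ_)
  open PolynomialRing R
  open SetoidReasoning setoid

  VanishesAbove : Poly → ℕ → Set ℓ
  VanishesAbove p d = ∀ k → d < k → coeff p k ≈ 0#

  vanishesAbove-tail : ∀ {a p d} → VanishesAbove (a ∷ p) (suc d) → VanishesAbove p d
  vanishesAbove-tail v k d<k = v (suc k) (s≤s d<k)

  constant-tail : ∀ {a p} → VanishesAbove (a ∷ p) 0 → p ≋ []
  constant-tail v = coeffwise λ k → v (suc k) (s≤s z≤n)

  private
    coeff-∷-* : ∀ a p q k → coeff ((a ∷ p) *ₚ q) k ≈ a * coeff q k + coeff (0# ∷ p *ₚ q) k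
    coeff-∷-* a p q k = trans (coeff-+ (a · q) (0# ∷ p *ₚ q) k) (+-congʳ (coeff-· a q k))

  vanishesAbove-* : ∀ p q {a b} → VanishesAbove p a → VanishesAbove q b →
                    VanishesAbove (p *ₚ q) (a ℕ.+ b)
  vanishesAbove-* []      q         vp vq k       l = refl
  vanishesAbove-* (x ∷ p) q {a} {b} vp vq (suc k) l = begin
    coeff ((x ∷ p) *ₚ q) (suc k)            ≈⟨ coeff-∷-* x p q (suc k) ⟩
    x * coeff q (suc k) + coeff (p *ₚ q) k  ≈⟨ +-cong (*-congˡ (vq (suc k) (ℕ.≤-<-trans (ℕ.m≤n+m b a) l))) (tail a vp l) ⟩
    x * 0# + 0#                             ≈⟨ +-identityʳ _ ⟩
    x * 0#                                  ≈⟨ zeroʳ x ⟩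
    0#                                      ∎
    where
    tail : ∀ a → VanishesAbove (x ∷ p) a → a ℕ.+ b < suc k → coeff (p *ₚ q) k ≈ 0#
    tail zero    v l       = at (*ₚ-cong {q = q} (constant-tail v) ≋-refl) k
    tail (suc a) v (s≤s l) = vanishesAbove-* p q (vanishesAbove-tail v) vq k l

  coeff-*-top : ∀ p q {a b} → VanishesAbove p a → VanishesAbove q b →
                coeff (p *ₚ q) (a ℕ.+ b) ≈ coeff p a * coeff q b
  coeff-*-top []      q             vp vq = sym (zeroˡ _)
  coeff-*-top (x ∷ p) q {zero}  {b} vp vq = begin
    coeff ((x ∷ p) *ₚ q) b                  ≈⟨ coeff-∷-* x p q b ⟩
    x * coeff q b + coeff (0# ∷ p *ₚ q) b   ≈⟨ +-congˡ (at (∷-zero refl (*ₚ-cong {q = q} (constant-tail vp) ≋-refl)) b) ⟩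
    x * coeff q b + 0#                      ≈⟨ +-identityʳ _ ⟩
    x * coeff q b                           ∎
  coeff-*-top (x ∷ p) q {suc a} {b} vp vq = begin
    coeff ((x ∷ p) *ₚ q) (suc a ℕ.+ b)
      ≈⟨ coeff-∷-* x p q (suc a ℕ.+ b) ⟩
    x * coeff q (suc a ℕ.+ b) + coeff (p *ₚ q) (a ℕ.+ b)
      ≈⟨ +-cong (trans (*-congˡ (vq _ (s≤s (ℕ.m≤n+m b a)))) (zeroʳ x)) (coeff-*-top p q (vanishesAbove-tail vp) vq) ⟩
    0# + coeff p a * coeff q b
      ≈⟨ +-identityˡ _ ⟩
    coeff p a * coeff q b ∎

module CharacteristicPolynomialDegree {c ℓ} (R : CommutativeRing c ℓ) where
  open CommutativeRing R hiding (zero)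
  open Polynomial rawRing using (Poly; coeff; _+ₚ_; _*ₚ_; -ₚ_; const; indeterminate; polyRing)
  open PolynomialRing R
  open Degree R
  open SetoidReasoning setoid
  open RawSemiringDefinitions (Semiring.rawSemiring semiring) using (_^_)
  open SemiringSum semiring using (sum)
  private
    module Pᴿ = RawSemiringDefinitions (RawRing.rawSemiring polyRing)
    module M = Matrices rawRing
    module Mₚ = Matrices polyRing

  const-^ : ∀ a k → const a Pᴿ.^ k ≋ const (a ^ k)
  const-^ a zero    = ≋-refl
  const-^ a (suc k) = ≋-trans (const-* a (const a Pᴿ.^ k)) (·-cong refl (const-^ a k))

  -- The coefficient `a` may be zero, as it is for the entries of λI - A off the diagonal. Sums of
  -- polynomials of the same bound `d` can therefore be treated without tracking cancellation.
  Leading : Poly → ℕ → Carrier → Set ℓ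
  Leading p d a = VanishesAbove p d × coeff p d ≈ a

  leading-* : ∀ p q {d e a b} → Leading p d a → Leading q e b → Leading (p *ₚ q) (d ℕ.+ e) (a * b)
  leading-* p q (vp , p≈a) (vq , q≈b) =
    vanishesAbove-* p q vp vq , trans (coeff-*-top p q vp vq) (*-cong p≈a q≈b)

  leading-sum : ∀ {n} (v : Vector Poly n) {d} {a : Vector Carrier n} →
                (∀ i → Leading (v i) d (a i)) → Leading (Pᴿ.sum v) d (sum a)
  leading-sum {zero}  v l = (λ _ _ → refl) , refl
  leading-sum {suc n} v {d} l with l zero | leading-sum (Vector.tail v) (λ i → l (suc i))
  ... | v₀ , e₀ | v₁ , e₁ =
    (λ k d<k → trans (coeff-+ (v zero) _ k) (trans (+-cong (v₀ k d<k) (v₁ k d<k)) (+-identityʳ 0#)))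
    , trans (coeff-+ (v zero) _ d) (+-cong e₀ e₁)

  -- In each term of the expansion the sign has degree 0, the entry degree at most 1 and the minor
  -- degree at most one less than the size, so the top coefficients are expanded by the same
  -- formula.
  leading-det : ∀ {n} (A : Mₚ.Matrix n) (B : M.Matrix n) → (∀ i j → Leading (A i j) 1 (B i j)) →
                Leading (Mₚ.det A) n (M.det B)
  leading-det {zero}  A B l = (λ { (suc k) _ → refl }) , refl
  leading-det {suc n} A B l = leading-sum term λ j →
    leading-* (sign j) (A zero j *ₚ minor j) (leading-sign j)
      (leading-* (A zero j) (minor j) (l zero j)
        (leading-det (λ i → removeAt (A (suc i)) j) (λ i → removeAt (B (suc i)) j)
          (λ i k → l (suc i) (punchIn j k))))
    where
    sign minor term : Vector Poly (suc n)
    sign j = (-ₚ const 1#) Pᴿ.^ toℕ j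
    minor j = Mₚ.det (λ i → removeAt (A (suc i)) j)
    term j = sign j *ₚ (A zero j *ₚ minor j)

    leading-sign : ∀ j → Leading (sign j) 0 ((- 1#) ^ toℕ j)
    leading-sign j =
      (λ { (suc k) _ → at (const-^ (- 1#) (toℕ j)) (suc k) }) , at (const-^ (- 1#) (toℕ j)) 0

  -- The coefficients of λ in the entries of λI - A are the entries of I, and det I = 1.
  charPoly-monic : ∀ {n} (A : M.Matrix n) → Leading (CharacteristicPolynomial.charPoly rawRing A) n 1#
  charPoly-monic {n} A with leading-det (λ i j → Mₚ.scalar indeterminate i j +ₚ (-ₚ const (A i j))) (M.scalar 1#) entries
    where
    entries : ∀ i j → Leading (Mₚ.scalar indeterminate i j +ₚ (-ₚ const (A i j))) 1 (M.scalar 1# i j)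
    entries i j with i ≟ j
    ... | yes _ = (λ { (suc (suc k)) _ → refl ; (suc zero) (s≤s ()) }) , refl
    ... | no _  = (λ { (suc k) _ → refl }) , refl
  ... | vanishes , leading = vanishes , trans leading (Determinant.det-scalar-1 R n)

-- Linear dependence over a discrete field.

-- The field axiom is a decision that also returns the inverse: pivots, degrees and quotients all
-- have to be computed.
record DiscreteField c ℓ : Set (lsuc (c ⊔ ℓ)) where
  field
    commutativeRing : CommutativeRing c ℓ
  open CommutativeRing commutativeRing public hiding (zero)
  field
    1≉0          : ¬ 1# ≈ 0#
    zero-or-unit : ∀ x → x ≈ 0# ⊎ (∃[ y ] x * y ≈ 1#)

  unit⇒≉0 : ∀ {x y} → x * y ≈ 1# → ¬ x ≈ 0#
  unit⇒≉0 xy≈1 x≈0 = 1≉0 (trans (sym xy≈1) (trans (*-congʳ x≈0) (zeroˡ _)))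

  ≉0-* : ∀ {x y} → ¬ x ≈ 0# → ¬ y ≈ 0# → ¬ x * y ≈ 0#
  ≉0-* {x} {y} x≉0 y≉0 xy≈0 with zero-or-unit x
  ... | inj₁ x≈0 = x≉0 x≈0
  ... | inj₂ (z , xz≈1) = y≉0 (begin
    y            ≈⟨ *-identityˡ y ⟨
    1# * y       ≈⟨ *-congʳ (trans (sym xz≈1) (*-comm x z)) ⟩
    (z * x) * y  ≈⟨ *-assoc z x y ⟩
    z * (x * y)  ≈⟨ *-congˡ xy≈0 ⟩
    z * 0#       ≈⟨ zeroʳ z ⟩
    0#           ∎)
    where open SetoidReasoning setoid

module LinearDependence {c ℓ} (K : DiscreteField c ℓ) where
  open DiscreteField K
  open SemiringSum semiring
    using (sum-syntax; sum-cong-≋; *-distribʳ-sum; ∑-distrib-+; sum-remove)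
  open RingProperties ring using (-‿distribˡ-*)
  open RingSolver commutativeSemiring using (solve; _:+_; _:*_; _:=_)
  open SetoidReasoning setoid

  Nonzero : ∀ {n} → Vector Carrier n → Set ℓ
  Nonzero v = ∃[ i ] ¬ v i ≈ 0#

  pivot? : ∀ {n} (v : Vector Carrier n) → (∀ i → v i ≈ 0#) ⊎ (∃[ i ] ∃[ y ] v i * y ≈ 1#)
  pivot? {zero}  v = inj₁ λ ()
  pivot? {suc n} v with zero-or-unit (v zero)
  ... | inj₂ (y , e) = inj₂ (zero , y , e)
  ... | inj₁ v₀≈0 with pivot? (Vector.tail v)
  ...   | inj₁ v≈0 = inj₁ λ { zero → v₀≈0 ; (suc i) → v≈0 i }
  ...   | inj₂ (i , y , e) = inj₂ (suc i , y , e)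

  -- Gaussian elimination on the first coordinate. If it vanishes throughout, one vector and that
  -- coordinate are dropped; otherwise a pivot vector clears it from the remaining ones.
  dependent : ∀ d (v : Vector (Vector Carrier d) (suc d)) →
    ∃[ t ] Nonzero t × (∀ k → ∑[ i < suc d ] (t i * v i k) ≈ 0#)
  dependent zero    v = (λ _ → 1#) , (zero , 1≉0) , λ ()
  dependent (suc d) v with pivot? (λ i → v i zero)
  ... | inj₁ v₀≈0 with dependent d (λ i k → v (suc i) (suc k))
  ...   | t , (i , tᵢ≉0) , e = 0# Vector.∷ t , (suc i , tᵢ≉0) , λ
    { zero    → Determinant.sum-zero commutativeRing {suc (suc d)} λ i →
                  trans (*-congˡ {(0# Vector.∷ t) i} (v₀≈0 i)) (zeroʳ _)
    ; (suc k) → trans (+-cong (zeroˡ _) (e k)) (+-identityʳ 0#) }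
  dependent (suc d) v | inj₂ (i , y , vᵢy≈1) = t , (punchIn i j , λ tⱼ≈0 → sⱼ≉0
      (trans (reflexive (≡.sym (insertAt-punchIn s i τ j))) tⱼ≈0)) , vanishes
    where
    u w : Vector (Vector Carrier (suc d)) (suc d)
    u = removeAt v i
    w j k = u j k + - (u j zero * y) * v i k

    w₀≈0 : ∀ j → w j zero ≈ 0#
    w₀≈0 j = begin
      u j zero + - (u j zero * y) * v i zero    ≈⟨ +-congˡ (-‿distribˡ-* _ _) ⟨
      u j zero + - ((u j zero * y) * v i zero)  ≈⟨ +-congˡ (-‿cong (trans (*-assoc _ _ _) (*-congˡ (trans (*-comm _ _) vᵢy≈1)))) ⟩
      u j zero + - (u j zero * 1#)              ≈⟨ +-congˡ (-‿cong (*-identityʳ _)) ⟩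
      u j zero + - u j zero                     ≈⟨ -‿inverseʳ _ ⟩
      0#                                        ∎

    IH = dependent d (λ j k → w j (suc k))
    s = let (s , _) = IH in s
    j = let (_ , (j , _) , _) = IH in j
    sⱼ≉0 = let (_ , (_ , sⱼ≉0) , _) = IH in sⱼ≉0

    sw≈0 : ∀ k → ∑[ j < suc d ] (s j * w j k) ≈ 0#
    sw≈0 zero    = Determinant.sum-zero commutativeRing {suc d} λ j → trans (*-congˡ {s j} (w₀≈0 j)) (zeroʳ _)
    sw≈0 (suc k) = let (_ , _ , e) = IH in e k

    -- The pivot vector receives everything that was added to the others: Σⱼ sⱼ wⱼ = Σⱼ sⱼ uⱼ + τ
    -- vᵢ.
    τ = ∑[ j < suc d ] (s j * - (u j zero * y))
    t = insertAt s i τ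

    vanishes : ∀ k → ∑[ j < suc (suc d) ] (t j * v j k) ≈ 0#
    vanishes k = begin
      ∑[ j < suc (suc d) ] (t j * v j k)
        ≈⟨ sum-remove {suc d} {i} (λ j → t j * v j k) ⟩
      t i * v i k + ∑[ j < suc d ] (t (punchIn i j) * u j k)
        ≈⟨ +-cong (*-congʳ (reflexive (insertAt-lookup s i τ)))
             (sum-cong-≋ {suc d} λ j → *-congʳ {u j k} (reflexive (insertAt-punchIn s i τ j))) ⟩
      τ * v i k + ∑[ j < suc d ] (s j * u j k)
        ≈⟨ +-congʳ (*-distribʳ-sum {suc d} (v i k) (λ j → s j * - (u j zero * y))) ⟩
      ∑[ j < suc d ] ((s j * - (u j zero * y)) * v i k) + ∑[ j < suc d ] (s j * u j k)
        ≈⟨ ∑-distrib-+ {suc d} (λ j → (s j * - (u j zero * y)) * v i k) (λ j → s j * u j k) ⟨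
      ∑[ j < suc d ] ((s j * - (u j zero * y)) * v i k + s j * u j k)
        ≈⟨ sum-cong-≋ {suc d} (λ j → solve 4 (λ s a b u → (s :* a) :* b :+ s :* u := s :* (u :+ a :* b))
             refl (s j) (- (u j zero * y)) (v i k) (u j k)) ⟩
      ∑[ j < suc d ] (s j * w j k)
        ≈⟨ sw≈0 k ⟩
      0# ∎

-- Division with remainder, Bézout identities, dependence modulo a polynomial.

module Euclidean {c ℓ} (K : DiscreteField c ℓ) where
  open DiscreteField K
  open Polynomial rawRing using (Poly; coeff; _+ₚ_; _*ₚ_; -ₚ_; const; HasDegree)
  open PolynomialRing commutativeRing
  open Degree commutativeRing
  open LinearDependence K
  private
    module P = CommutativeRing polynomialRing
    module PS = SemiringSum P.semiring
    module ∑ = SemiringSum semiring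
    module ≋ = SetoidReasoning P.setoid
  open ∑ using (sum-syntax)
  open SemiringDivisibility P.semiring using (_∣_; ∣ʳ-refl)
  open RingSolver P.commutativeSemiring using (solve; _:+_; _:*_; _:=_)
  open SetoidReasoning setoid

  VanishesFrom : Poly → ℕ → Set ℓ
  VanishesFrom p d = ∀ k → d ≤ k → coeff p k ≈ 0#

  degree? : ∀ p → p ≋ [] ⊎ (∃[ d ] HasDegree p d)
  degree? []      = inj₁ ≋-refl
  degree? (a ∷ p) with degree? p | zero-or-unit a
  ... | inj₂ (d , p≉0 , v) | _ = inj₂ (suc d , p≉0 , λ { (suc k) (s≤s d<k) → v k d<k })
  ... | inj₁ p≋0 | inj₁ a≈0 = inj₁ (∷-zero a≈0 p≋0)
  ... | inj₁ p≋0 | inj₂ (_ , ay≈1) = inj₂ (0 , unit⇒≉0 ay≈1 , λ { (suc k) _ → at p≋0 k })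

  -- A nonzero cofactor of degree m would give the product the coefficient sₘ fₙ ≠ 0 in degree m +
  -- n, where `r` vanishes.
  multiple-small⇒0 : ∀ {f r n} → HasDegree f n → f ∣ r → VanishesFrom r n → r ≋ []
  multiple-small⇒0 {f} {r} {n} (fₙ≉0 , vf) (s , sf≋r) vr with degree? s
  ... | inj₁ s≋0 = ≋-trans (≋-sym sf≋r) (*ₚ-cong {q = f} s≋0 ≋-refl)
  ... | inj₂ (m , sₘ≉0 , vs) = ⊥-elim (≉0-* sₘ≉0 fₙ≉0 (begin
    coeff s m * coeff f n     ≈⟨ coeff-*-top s f vs vf ⟨
    coeff (s *ₚ f) (m ℕ.+ n)  ≈⟨ at sf≋r (m ℕ.+ n) ⟩
    coeff r (m ℕ.+ n)         ≈⟨ vr _ (ℕ.m≤n+m n m) ⟩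
    0#                        ∎))

  -- Recursion on the coefficients of the dividend: from f = q g + r one gets a + λ f = (λ q) g + (a
  -- + λ r), and only the coefficient of degree n in the last summand has to be removed.
  division : ∀ {g n} → HasDegree g n → ∀ f →
    ∃[ q ] ∃[ r ] f ≋ q *ₚ g +ₚ r × VanishesFrom r n
  division {g} {n} g-deg [] = [] , [] , ≋-refl , λ _ _ → refl
  division {g} {n} g-deg@(gₙ≉0 , vg) (a ∷ f) with zero-or-unit (coeff g n) | division g-deg f
  ... | inj₁ gₙ≈0 | _ = ⊥-elim (gₙ≉0 gₙ≈0)
  ... | inj₂ (y , gₙy≈1) | q , r , f≋qg+r , vr = (0# ∷ q) +ₚ const t , (a ∷ r) +ₚ -ₚ (t · g) , eq , v
    where
    -- `y` inverts the leading coefficient of `g`, so subtracting t g cancels degree n.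
    t = coeff (a ∷ r) n * y

    eq : a ∷ f ≋ ((0# ∷ q) +ₚ const t) *ₚ g +ₚ ((a ∷ r) +ₚ -ₚ (t · g))
    eq = ≋.begin
      a ∷ f
        ≋.≈⟨ ∷-cong (sym (+-identityˡ a)) f≋qg+r ⟩
      (0# ∷ q *ₚ g) +ₚ (a ∷ r)
        ≋.≈⟨ +ₚ-cong (≋-sym (0∷-* q g)) (≋-sym (cancel (t · g) (a ∷ r))) ⟩
      (0# ∷ q) *ₚ g +ₚ (t · g +ₚ ((a ∷ r) +ₚ -ₚ (t · g)))
        ≋.≈⟨ P.+-assoc ((0# ∷ q) *ₚ g) (t · g) ((a ∷ r) +ₚ -ₚ (t · g)) ⟨
      ((0# ∷ q) *ₚ g +ₚ t · g) +ₚ ((a ∷ r) +ₚ -ₚ (t · g))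
        ≋.≈⟨ P.+-congʳ {(a ∷ r) +ₚ -ₚ (t · g)} (P.+-congˡ {(0# ∷ q) *ₚ g} (≋-sym (const-* t g))) ⟩
      ((0# ∷ q) *ₚ g +ₚ const t *ₚ g) +ₚ ((a ∷ r) +ₚ -ₚ (t · g))
        ≋.≈⟨ P.+-congʳ {(a ∷ r) +ₚ -ₚ (t · g)} (≋-sym (*ₚ-distribʳ g (0# ∷ q) (const t))) ⟩
      ((0# ∷ q) +ₚ const t) *ₚ g +ₚ ((a ∷ r) +ₚ -ₚ (t · g)) ≋.∎
      where
      cancel : ∀ x y → x +ₚ (y +ₚ -ₚ x) ≋ y
      cancel x y = ≋-trans (≋-sym (P.+-assoc x y (-ₚ x))) (AbelianGroupProperties.xyx⁻¹≈y P.+-abelianGroup x y)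

    coeff-r′ : ∀ k → coeff ((a ∷ r) +ₚ -ₚ (t · g)) k ≈ coeff (a ∷ r) k + - (t * coeff g k)
    coeff-r′ k = trans (coeff-+ (a ∷ r) (-ₚ (t · g)) k) (+-congˡ (trans (coeff-neg (t · g) k) (-‿cong (coeff-· t g k))))

    v : VanishesFrom ((a ∷ r) +ₚ -ₚ (t · g)) n
    v k n≤k with ℕ.m≤n⇒m<n∨m≡n n≤k
    ... | inj₂ ≡.refl = begin
      coeff ((a ∷ r) +ₚ -ₚ (t · g)) n                     ≈⟨ coeff-r′ n ⟩
      coeff (a ∷ r) n + - (coeff (a ∷ r) n * y * coeff g n)
        ≈⟨ +-congˡ (-‿cong (trans (*-assoc _ _ _) (trans (*-congˡ (trans (*-comm _ _) gₙy≈1)) (*-identityʳ _)))) ⟩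
      coeff (a ∷ r) n + - coeff (a ∷ r) n                 ≈⟨ -‿inverseʳ _ ⟩
      0#                                                  ∎
    v (suc k) _ | inj₁ n<k@(s≤s n≤k) = begin
      coeff ((a ∷ r) +ₚ -ₚ (t · g)) (suc k)               ≈⟨ coeff-r′ (suc k) ⟩
      coeff r k + - (t * coeff g (suc k))
        ≈⟨ +-cong (vr k n≤k) (-‿cong (trans (*-congˡ (vg (suc k) n<k)) (zeroʳ t))) ⟩
      0# + - 0#                                           ≈⟨ -‿inverseʳ 0# ⟩
      0#                                                  ∎

  record Bézout (f g : Poly) : Set (c ⊔ ℓ) where
    field
      d u v  : Poly
      d∣f    : d ∣ f
      d∣g    : d ∣ g
      d≋uf+vg : d ≋ u *ₚ f +ₚ v *ₚ g

  -- Euclid's algorithm made structural by the bound `n`: it drops either because the coefficient of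
  -- `g` just below it is zero, or because a remainder modulo `g` takes the place of `g`.
  bézout′ : ∀ n f g → VanishesFrom g n → Bézout f g
  bézout′ zero f g v = record
    { d = f ; u = const 1# ; v = [] ; d∣f = ∣ʳ-refl
    ; d∣g = [] , coeffwise λ k → sym (v k z≤n)
    ; d≋uf+vg = ≋-sym (≋-trans (+ₚ-identityʳ _) (*ₚ-identityˡ f)) }
  bézout′ (suc n) f g v with zero-or-unit (coeff g n)
  ... | inj₁ gₙ≈0 = bézout′ n f g v′
    where
    v′ : VanishesFrom g n
    v′ k n≤k with ℕ.m≤n⇒m<n∨m≡n n≤k
    ... | inj₁ n<k    = v k n<k
    ... | inj₂ ≡.refl = gₙ≈0
  ... | inj₂ (y , gₙy≈1) with division {g} {n} (unit⇒≉0 gₙy≈1 , v) f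
  ...   | q , r , f≋qg+r , vr with bézout′ n g r vr
  ...     | b = record
    { d = d ; u = v₁ ; v = u +ₚ v₁ *ₚ (-ₚ q) ; d∣g = d∣f
    ; d∣f = resp (≋-sym f≋qg+r) (+-closed {q *ₚ g} {r} (*-closed q d∣f) d∣g)
    ; d≋uf+vg = ≋.begin
        d
          ≋.≈⟨ d≋uf+vg ⟩
        u *ₚ g +ₚ v₁ *ₚ r
          ≋.≈⟨ +ₚ-cong (≋-refl {u *ₚ g}) (*ₚ-congˡ v₁ r≋) ⟩
        u *ₚ g +ₚ v₁ *ₚ (f +ₚ (-ₚ q) *ₚ g)
          ≋.≈⟨ solve 5 (λ u v f g q → u :* g :+ v :* (f :+ q :* g) := v :* f :+ (u :+ v :* q) :* g)
                 ≋-refl u v₁ f g (-ₚ q) ⟩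
        v₁ *ₚ f +ₚ (u +ₚ v₁ *ₚ (-ₚ q)) *ₚ g ≋.∎ }
    where
    open Bézout b renaming (v to v₁)
    open IsLeftIdeal (multiples-isLeftIdeal polynomialRing d)

    r≋ : r ≋ f +ₚ (-ₚ q) *ₚ g
    r≋ = ≋.begin
      r                                   ≋.≈⟨ AbelianGroupProperties.xyx⁻¹≈y P.+-abelianGroup (q *ₚ g) r ⟨
      (q *ₚ g +ₚ r) +ₚ -ₚ (q *ₚ g)        ≋.≈⟨ +ₚ-cong (≋-sym f≋qg+r) (RingProperties.-‿distribˡ-* P.ring q g) ⟩
      f +ₚ (-ₚ q) *ₚ g                    ≋.∎

  bézout : ∀ f g → Bézout f g
  bézout f g with degree? g
  ... | inj₁ g≋0 = bézout′ 0 f g λ k _ → at g≋0 k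
  ... | inj₂ (d , _ , v) = bézout′ (suc d) f g v

  coeff-∑ : ∀ {n} (v : Vector Poly n) k → coeff (PS.sum v) k ≈ ∑[ i < n ] coeff (v i) k
  coeff-∑ {zero}  v k = refl
  coeff-∑ {suc n} v k = trans (coeff-+ (v zero) (PS.sum (Vector.tail v)) k) (+-congˡ (coeff-∑ (Vector.tail v) k))

  -- Modulo `g` only remainders matter, and these are vectors of `d` coefficients. A relation among
  -- them lifts, the same combination of the quotients being the cofactor of `g`.
  dependent-mod : ∀ {g d} → HasDegree g d → (v : Vector Poly (suc d)) →
    ∃[ t ] Nonzero t × g ∣ PS.sum (λ i → const (t i) *ₚ v i)
  dependent-mod {g} {d} g-deg v = t , t≉0 , PS.sum qt , ≋-sym (≋.begin
    PS.sum (λ i → const (t i) *ₚ v i)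
      ≋.≈⟨ PS.sum-cong-≋ {suc d} (λ i → ≋-trans (*ₚ-congˡ (const (t i)) (v≋ i))
             (solve 4 (λ t q g r → t :* (q :* g :+ r) := (t :* q) :* g :+ t :* r) ≋-refl (const (t i)) (q i) g (r i))) ⟩
    PS.sum (λ i → qt i *ₚ g +ₚ rt i)
      ≋.≈⟨ PS.∑-distrib-+ {suc d} (λ i → qt i *ₚ g) rt ⟩
    PS.sum (λ i → qt i *ₚ g) +ₚ PS.sum rt
      ≋.≈⟨ +ₚ-cong (≋-sym (PS.*-distribʳ-sum {suc d} g qt)) Σrt≋0 ⟩
    PS.sum qt *ₚ g +ₚ []
      ≋.≈⟨ +ₚ-identityʳ _ ⟩
    PS.sum qt *ₚ g ≋.∎)
    where
    q r : Vector Poly (suc d)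
    q i = let (q , _) = division g-deg (v i) in q
    r i = let (_ , r , _) = division g-deg (v i) in r

    v≋ : ∀ i → v i ≋ q i *ₚ g +ₚ r i
    v≋ i = let (_ , _ , e , _) = division g-deg (v i) in e

    vr : ∀ i → VanishesFrom (r i) d
    vr i = let (_ , _ , _ , z) = division g-deg (v i) in z

    dep = dependent d (λ i k → coeff (r i) (toℕ k))
    t = let (t , _) = dep in t
    t≉0 = let (_ , t≉0 , _) = dep in t≉0

    qt rt : Vector Poly (suc d)
    qt i = const (t i) *ₚ q i
    rt i = const (t i) *ₚ r i

    coeff-Σrt : ∀ k → coeff (PS.sum rt) k ≈ ∑[ i < suc d ] (t i * coeff (r i) k)
    coeff-Σrt k = trans (coeff-∑ rt k)
      (∑.sum-cong-≋ {suc d} λ i → trans (at (const-* (t i) (r i)) k) (coeff-· (t i) (r i) k))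

    Σrt≋0 : PS.sum rt ≋ []
    Σrt≋0 = coeffwise λ k → trans (coeff-Σrt k) (vanish k)
      where
      vanish : ∀ k → ∑[ i < suc d ] (t i * coeff (r i) k) ≈ 0#
      vanish k with k ℕ.<? d
      ... | yes k<d = ≡.subst (λ k → ∑[ i < suc d ] (t i * coeff (r i) k) ≈ 0#) (toℕ-fromℕ< k<d)
                        (let (_ , _ , e) = dep in e (fromℕ< k<d))
      ... | no k≮d  = Determinant.sum-zero commutativeRing {suc d} λ i →
                        trans (*-congˡ {t i} (vr i k (ℕ.≮⇒≥ k≮d))) (zeroʳ _)

-- The ring of matrices and the first column of the Cayley-Hamilton identity.

module MatrixRing {c ℓ} (R : CommutativeRing c ℓ) where
  open CommutativeRing R hiding (zero)
  open Matrices rawRing using (Matrix; scalar; matrixRing)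
  open SemiringSum semiring
    using (sum; sum-syntax; sum-cong-≋; *-distribʳ-sum; *-distribˡ-sum; ∑-distrib-+; ∑-comm; sum-remove)
  open Determinant R using (sum-zero)
  open RingProperties ring using (-0#≈0#)
  open SetoidReasoning setoid

  sum-single : ∀ {n} (v : Vector Carrier n) i → (∀ k → k ≢ i → v k ≈ 0#) → sum v ≈ v i
  sum-single {suc n} v i v≈0 = begin
    sum v                     ≈⟨ sum-remove {n} {i} v ⟩
    v i + sum (removeAt v i)  ≈⟨ +-congˡ (sum-zero λ k → v≈0 (punchIn i k) (punchInᵢ≢i i k)) ⟩
    v i + 0#                  ≈⟨ +-identityʳ _ ⟩
    v i                       ∎

  scalar-diagonal : ∀ {n} a (i : Fin n) → scalar a i i ≈ a
  scalar-diagonal a i with i ≟ i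
  ... | yes _  = refl
  ... | no i≢i = contradiction ≡.refl i≢i

  scalar-off-diagonal : ∀ {n} a {i k : Fin n} → i ≢ k → scalar a i k ≈ 0#
  scalar-off-diagonal a {i} {k} i≢k with i ≟ k
  ... | yes i≡k = contradiction i≡k i≢k
  ... | no _    = refl

  scalar-*ˡ : ∀ {n} a (v : Vector Carrier n) i → ∑[ k < n ] (scalar a i k * v k) ≈ a * v i
  scalar-*ˡ a v i = trans
    (sum-single (λ k → scalar a i k * v k) i
      (λ k k≢i → trans (*-congʳ (scalar-off-diagonal a (k≢i ∘ ≡.sym))) (zeroˡ _)))
    (*-congʳ (scalar-diagonal a i))

  scalar-*ʳ : ∀ {n} a (v : Vector Carrier n) j → ∑[ k < n ] (v k * scalar a k j) ≈ v j * a
  scalar-*ʳ a v j = trans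
    (sum-single (λ k → v k * scalar a k j) j
      (λ k k≢j → trans (*-congˡ (scalar-off-diagonal a k≢j)) (zeroʳ _)))
    (*-congˡ (scalar-diagonal a j))

  matrix-*-assoc : ∀ {l m n o} (A : Fin l → Fin m → Carrier) (B : Fin m → Fin n → Carrier)
    (C : Fin n → Fin o → Carrier) i j →
    ∑[ k < n ] (∑[ h < m ] (A i h * B h k) * C k j) ≈ ∑[ h < m ] (A i h * ∑[ k < n ] (B h k * C k j))
  matrix-*-assoc {m = m} {n} A B C i j = begin
    ∑[ k < n ] (∑[ h < m ] (A i h * B h k) * C k j)
      ≈⟨ sum-cong-≋ {n} (λ k → *-distribʳ-sum {m} (C k j) (λ h → A i h * B h k)) ⟩
    ∑[ k < n ] ∑[ h < m ] (A i h * B h k * C k j)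
      ≈⟨ ∑-comm {n} {m} (λ k h → A i h * B h k * C k j) ⟩
    ∑[ h < m ] ∑[ k < n ] (A i h * B h k * C k j)
      ≈⟨ sum-cong-≋ {m} (λ h → sum-cong-≋ {n} λ k → *-assoc (A i h) (B h k) (C k j)) ⟩
    ∑[ h < m ] ∑[ k < n ] (A i h * (B h k * C k j))
      ≈⟨ sum-cong-≋ {m} (λ h → *-distribˡ-sum {n} (A i h) (λ k → B h k * C k j)) ⟨
    ∑[ h < m ] (A i h * ∑[ k < n ] (B h k * C k j)) ∎

  ring-of-matrices : ℕ → Ring c ℓ
  ring-of-matrices n = record
    { Carrier = Matrix n ; _≈_ = M._≈_ ; _+_ = M._+_ ; _*_ = M._*_ ; -_ = M.-_ ; 0# = M.0# ; 1# = M.1#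
    ; isRing = record
      { +-isAbelianGroup = record
        { isGroup = record
          { isMonoid = record
            { isSemigroup = record
              { isMagma = record
                { isEquivalence = record
                  { refl = λ _ _ → refl
                  ; sym = λ e i j → sym (e i j)
                  ; trans = λ e f i j → trans (e i j) (f i j) }
                ; ∙-cong = λ e f i j → +-cong (e i j) (f i j) }
              ; assoc = λ A B C i j → +-assoc _ _ _ }
            ; identity = (λ A i j → +-identityˡ _) , (λ A i j → +-identityʳ _) }
          ; inverse = (λ A i j → -‿inverseˡ _) , (λ A i j → -‿inverseʳ _)
          ; ⁻¹-cong = λ e i j → -‿cong (e i j) }
        ; comm = λ A B i j → +-comm _ _ }
      ; *-cong = λ e f i j → sum-cong-≋ λ k → *-cong (e i k) (f k j)
      ; *-assoc = λ A B C i j → matrix-*-assoc A B C i j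
      ; *-identity =
          (λ A i j → trans (scalar-*ˡ 1# (λ k → A k j) i) (*-identityˡ _)) ,
          (λ A i j → trans (scalar-*ʳ 1# (A i) j) (*-identityʳ _))
      ; distrib =
          (λ A B C i j → trans (sum-cong-≋ {n} λ k → distribˡ (A i k) (B k j) (C k j))
            (∑-distrib-+ {n} (λ k → A i k * B k j) (λ k → A i k * C k j))) ,
          (λ A B C i j → trans (sum-cong-≋ {n} λ k → distribʳ (A k j) (B i k) (C i k))
            (∑-distrib-+ {n} (λ k → B i k * A k j) (λ k → C i k * A k j))) } }
    where module M = RawRing (matrixRing n)

  scalar-isRingHomomorphism : ∀ n → IsRingHomomorphism rawRing (matrixRing n) scalar
  scalar-isRingHomomorphism n = record
    { isSemiringHomomorphism = record
      { isNearSemiringHomomorphism = record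
        { +-isMonoidHomomorphism = record
          { isMagmaHomomorphism = record
            { isRelHomomorphism = record { cong = scalar-cong }
            ; homo = scalar-+ }
          ; ε-homo = scalar-0 }
        ; *-homo = λ a b i j → trans (scalar-· a b i j) (sym (scalar-*ˡ a (λ k → scalar b k j) i)) }
      ; 1#-homo = λ _ _ → refl }
    ; -‿homo = scalar-neg }
    where
    scalar-cong : ∀ {a b} → a ≈ b → ∀ i j → scalar {n} a i j ≈ scalar b i j
    scalar-cong e i j with i ≟ j
    ... | yes _ = e
    ... | no _  = refl

    scalar-+ : ∀ a b i j → scalar {n} (a + b) i j ≈ scalar a i j + scalar b i j
    scalar-+ a b i j with i ≟ j
    ... | yes _ = refl
    ... | no _  = sym (+-identityʳ 0#)

    scalar-0 : ∀ i j → scalar {n} 0# i j ≈ 0#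
    scalar-0 i j with i ≟ j
    ... | yes _ = refl
    ... | no _  = refl

    scalar-· : ∀ a b i j → scalar {n} (a * b) i j ≈ a * scalar b i j
    scalar-· a b i j with i ≟ j
    ... | yes _ = refl
    ... | no _  = sym (zeroʳ a)

    scalar-neg : ∀ a i j → scalar {n} (- a) i j ≈ - scalar a i j
    scalar-neg a i j with i ≟ j
    ... | yes _ = refl
    ... | no _  = sym -0#≈0#

  scalar-central : ∀ n a (X : Matrix n) i j →
    ∑[ k < n ] (scalar a i k * X k j) ≈ ∑[ k < n ] (X i k * scalar a k j)
  scalar-central n a X i j = begin
    ∑[ k < n ] (scalar a i k * X k j)  ≈⟨ scalar-*ˡ a (λ k → X k j) i ⟩
    a * X i j                          ≈⟨ *-comm _ _ ⟩
    X i j * a                          ≈⟨ scalar-*ʳ a (X i) j ⟨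
    ∑[ k < n ] (X i k * scalar a k j)  ∎

module EvaluationAtMatrix {c ℓ} (R : CommutativeRing c ℓ) (n : ℕ) where
  open MatrixRing R
  open Evaluation R (ring-of-matrices n) (Matrices.scalar (CommutativeRing.rawRing R))
    (scalar-isRingHomomorphism n) (scalar-central n) public
  open EvaluateComposition R (ring-of-matrices n) (Matrices.scalar (CommutativeRing.rawRing R))
    (scalar-isRingHomomorphism n) (scalar-central n) public

module CayleyHamilton {c ℓ} (R : CommutativeRing c ℓ) {n : ℕ}
  (A : Matrices.Matrix (CommutativeRing.rawRing R) (suc n)) where
  open CommutativeRing R hiding (zero)
  open Polynomial rawRing using (Poly; _+ₚ_; _*ₚ_; -ₚ_; const; indeterminate; polyRing)
  open PolynomialRing R
  open Matrices rawRing using (scalar)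
  open MatrixRing R
  open EvaluationAtMatrix R (suc n)
  open SemiringSum semiring
    using (sum; sum-syntax; sum-cong-≋; *-distribˡ-sum; ∑-distrib-+; ∑-comm)
  open Determinant R using (sum-zero)
  open RingProperties ring using (-0#≈0#)
  open SetoidReasoning setoid
  private
    module Dₚ = Determinant polynomialRing-≈ₚ
    module Pᴿ = RawSemiringDefinitions (RawRing.rawSemiring polyRing)
    module Mₚ = Matrices polyRing

  f : Poly
  f = CharacteristicPolynomial.charPoly rawRing A

  private
    N : Mₚ.Matrix (suc n)
    N i k = Mₚ.scalar indeterminate i k +ₚ (-ₚ const (A i k))

    b : Vector Poly (suc n)
    b = Dₚ.cofactor N

    ⟦⟧-sum : ∀ {m} (v : Vector Poly m) r s → ⟦ Pᴿ.sum v ⟧ A r s ≈ ∑[ k < m ] ⟦ v k ⟧ A r s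
    ⟦⟧-sum {zero}  v r s = refl
    ⟦⟧-sum {suc m} v r s = trans (⟦⟧-+ (v zero) (Pᴿ.sum (Vector.tail v)) A r s) (+-congˡ (⟦⟧-sum (Vector.tail v) r s))

  -- Σᵢ (δᵢₖ A − aᵢₖ I) eᵢ = A eₖ − Σᵢ aᵢₖ eᵢ = 0 for the basis vectors eᵢ.
  column-sum : ∀ k s → ∑[ i < suc n ] ⟦ N i k ⟧ A s i ≈ 0#
  column-sum k s = begin
    ∑[ i < suc n ] ⟦ N i k ⟧ A s i
      ≈⟨ sum-cong-≋ {suc n} (λ i → trans (⟦⟧-+ (Mₚ.scalar indeterminate i k) (-ₚ const (A i k)) A s i)
           (+-congˡ (trans (⟦⟧-neg (const (A i k)) A s i) (-‿cong (⟦⟧-const (A i k) A s i))))) ⟩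
    ∑[ i < suc n ] (E i + F i)
      ≈⟨ ∑-distrib-+ {suc n} E F ⟩
    sum E + sum F
      ≈⟨ +-cong (trans (sum-single E k E-off) E-diagonal) (trans (sum-single F s F-off) F-diagonal) ⟩
    A s k + - A s k
      ≈⟨ -‿inverseʳ _ ⟩
    0# ∎
    where
    E F : Vector Carrier (suc n)
    E i = ⟦ Mₚ.scalar indeterminate i k ⟧ A s i
    F i = - scalar (A i k) s i

    E-off : ∀ i → i ≢ k → E i ≈ 0#
    E-off i i≢k with i ≟ k
    ... | yes i≡k = contradiction i≡k i≢k
    ... | no _    = refl

    E-diagonal : E k ≈ A s k
    E-diagonal with k ≟ k
    ... | yes _  = ⟦⟧-indeterminate A s k
    ... | no k≢k = contradiction ≡.refl k≢k

    F-off : ∀ i → i ≢ s → F i ≈ 0#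
    F-off i i≢s = trans (-‿cong (scalar-off-diagonal (A i k) (i≢s ∘ ≡.sym))) -0#≈0#

    F-diagonal : F s ≈ - A s k
    F-diagonal = -‿cong (scalar-diagonal (A s k) s)

  private
    T : Vector Poly (suc n)
    T i = Pᴿ.sum (λ k → b k *ₚ N i k)

    T-zero : T zero ≋ f
    T-zero = coeffwise (Dₚ.cofactor-zero N)

    T-suc : ∀ i → T (suc i) ≋ []
    T-suc i = coeffwise (Dₚ.cofactor-suc N i)

    T-nonzero : ∀ i → i ≢ zero → T i ≋ []
    T-nonzero zero    0≢0 = contradiction ≡.refl 0≢0
    T-nonzero (suc i) _   = T-suc i

  -- The cofactors bₖ of the first row of N = λI − A satisfy Σₖ bₖ Nᵢₖ = δ₀ᵢ f;
  -- evaluate at A, apply to eᵢ and sum over i.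
  first-column-zero : ∀ r → ⟦ f ⟧ A r zero ≈ 0#
  first-column-zero r = begin
    ⟦ f ⟧ A r zero
      ≈⟨ ⟦⟧-congˡ A T-zero r zero ⟨
    ⟦ T zero ⟧ A r zero
      ≈⟨ sum-single (λ i → ⟦ T i ⟧ A r i) zero (λ i i≢0 → ⟦⟧-zero A (T-nonzero i i≢0) r i) ⟨
    ∑[ i < suc n ] ⟦ T i ⟧ A r i
      ≈⟨ sum-cong-≋ {suc n} (λ i → trans (⟦⟧-sum (λ k → b k *ₚ N i k) r i)
           (sum-cong-≋ {suc n} λ k → ⟦⟧-* (b k) (N i k) A r i)) ⟩
    ∑[ i < suc n ] ∑[ k < suc n ] ∑[ s < suc n ] (B k s * ⟦ N i k ⟧ A s i)
      ≈⟨ ∑-comm {suc n} {suc n} (λ i k → ∑[ s < suc n ] (B k s * ⟦ N i k ⟧ A s i)) ⟩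
    ∑[ k < suc n ] ∑[ i < suc n ] ∑[ s < suc n ] (B k s * ⟦ N i k ⟧ A s i)
      ≈⟨ sum-zero {suc n} (λ k → begin
           ∑[ i < suc n ] ∑[ s < suc n ] (B k s * ⟦ N i k ⟧ A s i)
             ≈⟨ ∑-comm {suc n} {suc n} (λ i s → B k s * ⟦ N i k ⟧ A s i) ⟩
           ∑[ s < suc n ] ∑[ i < suc n ] (B k s * ⟦ N i k ⟧ A s i)
             ≈⟨ sum-zero {suc n} (λ s → trans
                  (sym (*-distribˡ-sum {suc n} (B k s) (λ i → ⟦ N i k ⟧ A s i)))
                  (trans (*-congˡ (column-sum k s)) (zeroʳ _))) ⟩
           0# ∎) ⟩
    0# ∎
    where
    B : Fin (suc n) → Fin (suc n) → Carrier
    B k s = ⟦ b k ⟧ A r s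

-- Congruences, irreducible polynomials, and the equivalence with (ii).

module Congruence {c ℓ} (R : CommutativeRing c ℓ) where
  open CommutativeRing R
  open SemiringDivisibility semiring using (_∣_)
  open SetoidReasoning setoid

  -- Subtraction-free, so that identities between congruences can be left to
  -- the semiring solver.
  infix 4 _≡_[mod_]
  _≡_[mod_] : Carrier → Carrier → Carrier → Set _
  a ≡ b [mod d ] = ∃[ s ] a ≈ b + s * d

  ≡-mod⇒∣ : ∀ {a b d} → a ≡ b [mod d ] → d ∣ a - b
  ≡-mod⇒∣ {a} {b} {d} (s , a≈b+sd) = s , (begin
    s * d            ≈⟨ AbelianGroupProperties.xyx⁻¹≈y +-abelianGroup b (s * d) ⟨
    b + s * d - b    ≈⟨ +-congʳ a≈b+sd ⟨
    a - b            ∎)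

  ∣⇒≡-mod : ∀ {a b d} → d ∣ a - b → a ≡ b [mod d ]
  ∣⇒≡-mod {a} {b} {d} (s , sd≈a-b) = s , (begin
    a                ≈⟨ AbelianGroupProperties.xyx⁻¹≈y +-abelianGroup b a ⟨
    b + a - b        ≈⟨ +-assoc b a (- b) ⟩
    b + (a - b)      ≈⟨ +-congˡ sd≈a-b ⟨
    b + s * d        ∎)

  ≡-mod-sym : ∀ {a b d} → a ≡ b [mod d ] → b ≡ a [mod d ]
  ≡-mod-sym {a} {b} {d} a≡b = ∣⇒≡-mod (resp (AbelianGroupProperties.⁻¹-anti-homo‿- +-abelianGroup a b) (neg-closed (≡-mod⇒∣ a≡b)))
    where open IsLeftIdeal (multiples-isLeftIdeal R d)

  ∣-resp-mod : ∀ {a b d} → a ≡ b [mod d ] → d ∣ b → d ∣ a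
  ∣-resp-mod {d = d} (s , e) d∣b = resp (sym e) (+-closed d∣b (s , refl))
    where open IsLeftIdeal (multiples-isLeftIdeal R d)

module IrreduciblePolynomial {c ℓ} (K : DiscreteField c ℓ) where
  open DiscreteField K
  open Polynomial rawRing
  open PolynomialRing commutativeRing
  open Composition commutativeRing
  open LinearDependence K
  open Euclidean K
  private
    module P = CommutativeRing polynomialRing
    module PS = SemiringSum P.semiring
  open RawSemiringDefinitions (Semiring.rawSemiring P.semiring) using (Irreducible; mkIrred; _^_)
  open SemiringDivisibility P.semiring using (_∣_; ∣ʳ-refl; ∣ʳ-respʳ-≈; ∣ʳ-trans)
  open Congruence polynomialRing
  open RingSolver P.commutativeSemiring using (solve; _:+_; _:*_; _:=_)
  open EvaluateComposition commutativeRing P.ring const const-isRingHomomorphism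
    (λ r p → P.*-comm (const r) p) public using () renaming (⟦⟧-comp to comp-assoc)
  open SetoidReasoning P.setoid

  ∣-comp-isLeftIdeal : ∀ d p → IsLeftIdeal P.ring (λ g → d ∣ comp g p)
  ∣-comp-isLeftIdeal d p = comp-isLeftIdeal (multiples-isLeftIdeal polynomialRing d) p

  comp-cong-mod : ∀ r {a b d} → a ≡ b [mod d ] → comp r a ≡ comp r b [mod d ]
  comp-cong-mod []      {a} {b} {d} e = [] , ≋-refl
  comp-cong-mod (x ∷ r) {a} {b} {d} (s , e) with comp-cong-mod r {a} {b} {d} (s , e)
  ... | s′ , e′ = s *ₚ comp r b +ₚ b *ₚ s′ +ₚ s *ₚ d *ₚ s′ , (begin
    const x +ₚ a *ₚ comp r a
      ≈⟨ +ₚ-cong (≋-refl {const x}) (*ₚ-cong e e′) ⟩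
    const x +ₚ (b +ₚ s *ₚ d) *ₚ (comp r b +ₚ s′ *ₚ d)
      ≈⟨ solve 6 (λ x b s d r s′ → x :+ (b :+ s :* d) :* (r :+ s′ :* d)
           := (x :+ b :* r) :+ (s :* r :+ b :* s′ :+ s :* d :* s′) :* d)
           ≋-refl (const x) b s d (comp r b) s′ ⟩
    (const x +ₚ b *ₚ comp r b) +ₚ (s *ₚ comp r b +ₚ b *ₚ s′ +ₚ s *ₚ d *ₚ s′) *ₚ d ∎)

  coeff-tabulate : ∀ {n} (t : Vector Carrier n) i → coeff (tabulate t) (toℕ i) ≡ t i
  coeff-tabulate t zero    = ≡.refl
  coeff-tabulate t (suc i) = coeff-tabulate (Vector.tail t) i

  tabulate-vanishesFrom : ∀ {n} (t : Vector Carrier n) → VanishesFrom (tabulate t) n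
  tabulate-vanishesFrom {zero}  t k       _         = refl
  tabulate-vanishesFrom {suc n} t (suc k) (s≤s n≤k) = tabulate-vanishesFrom (Vector.tail t) k n≤k

  tabulate-zero : ∀ {n} (t : Vector Carrier n) → tabulate t ≋ [] → ∀ i → t i ≈ 0#
  tabulate-zero t e i = trans (reflexive (≡.sym (coeff-tabulate t i))) (at e (toℕ i))

  tabulate-nonzero : ∀ {n} (t : Vector Carrier n) → Nonzero t → ¬ tabulate t ≋ []
  tabulate-nonzero t (i , tᵢ≉0) e = tᵢ≉0 (tabulate-zero t e i)

  -- Irreducibility is applied to f = x d with d = gcd(f, g). If x is a unit, f divides d and hence
  -- g; if d is a unit, the Bézout identity is rescaled to 1.
  irreducible-∣-or-coprime : ∀ {f} → Irreducible f → ∀ g →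
    f ∣ g ⊎ (∃[ u ] ∃[ v ] u *ₚ f +ₚ v *ₚ g ≋ const 1#)
  irreducible-∣-or-coprime {f} (mkIrred _ split) g = go (bézout f g)
    where
    go : Bézout f g → f ∣ g ⊎ (∃[ u ] ∃[ v ] u *ₚ f +ₚ v *ₚ g ≋ const 1#)
    go b = cases d∣f
      where
      open Bézout b

      cases : d ∣ f → f ∣ g ⊎ (∃[ u ] ∃[ v ] u *ₚ f +ₚ v *ₚ g ≋ const 1#)
      cases (x , xd≋f) with split {x} {d} (≋-sym xd≋f)
      ... | inj₁ (w , wx≋1) = inj₁ (∣ʳ-trans {f} {d} {g} (w , (begin
        w *ₚ f          ≈⟨ *ₚ-congˡ w (≋-sym xd≋f) ⟩
        w *ₚ (x *ₚ d)   ≈⟨ *ₚ-assoc w x d ⟨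
        (w *ₚ x) *ₚ d   ≈⟨ *ₚ-cong {q = d} wx≋1 ≋-refl ⟩
        const 1# *ₚ d   ≈⟨ *ₚ-identityˡ d ⟩
        d               ∎)) d∣g)
      ... | inj₂ (w , wd≋1) = inj₂ (w *ₚ u , w *ₚ v , (begin
        w *ₚ u *ₚ f +ₚ w *ₚ v *ₚ g
          ≈⟨ solve 5 (λ w u v f g → w :* u :* f :+ w :* v :* g := w :* (u :* f :+ v :* g)) ≋-refl w u v f g ⟩
        w *ₚ (u *ₚ f +ₚ v *ₚ g)
          ≈⟨ *ₚ-congˡ w (≋-sym d≋uf+vg) ⟩
        w *ₚ d
          ≈⟨ wd≋1 ⟩
        const 1# ∎))

  -- If f did not divide g, both would combine to 1, which would then lie in `J`.
  irreducible-generates : ∀ {f j} {J : Pred Poly j} → Irreducible f → IsLeftIdeal P.ring J →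
    ¬ J (const 1#) → J f → ∀ {g} → J g → f ∣ g
  irreducible-generates {f} f-irr ideal 1∉J Jf {g} Jg with irreducible-∣-or-coprime f-irr g
  ... | inj₁ f∣g = f∣g
  ... | inj₂ (u , v , uf+vg≋1) =
    ⊥-elim (1∉J (resp uf+vg≋1 (+-closed {u *ₚ f} {v *ₚ g} (*-closed u Jf) (*-closed v Jg))))
    where open IsLeftIdeal ideal

  -- The condition through which all three statements of the theorem are
  -- compared: p has a preimage of λ in the field K[λ]/(f).
  SolvableModulo : Poly → Poly → Set _
  SolvableModulo f p = ∃[ q ] comp p q ≡ indeterminate [mod f ]

  -- If t₀ v + Σᵢ tᵢ₊₁ pⁱ ≡ 0 with t₀ a unit, then v ≡ q(p) for this q.
  solve-for-head : ∀ {n} → Carrier → Vector Carrier n → Poly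
  solve-for-head y t = -ₚ (y · tabulate t)

  module _ {f n} (f-irr : Irreducible f) (f-deg : HasDegree f (suc n)) (p : Poly) where

    -- Once λ ≡ q(p) modulo h, substituting both sides into p gives p(q(p)) ≡ p modulo h. Thus h
    -- divides p(q(λ)) - λ evaluated at p(λ), and such polynomials are multiples of f.
    factor⇒solvable : ∃[ h ] HasDegree h (suc n) × h ∣ comp f p → SolvableModulo f p
    factor⇒solvable (h , h-deg , h∣fp) = go (dependent-mod h-deg v)
      where
      v : Vector Poly (suc (suc n))
      v = indeterminate Vector.∷ λ i → p ^ toℕ i

      -- The ideal is proper because h has positive degree.
      h∤1 : ¬ h ∣ comp (const 1#) p
      h∤1 h∣1 = 1≉0 (at (multiple-small⇒0 h-deg (∣ʳ-respʳ-≈ (comp-1 p) h∣1) λ { (suc k) _ → refl }) 0)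

      generates : ∀ {g} → h ∣ comp g p → f ∣ g
      generates = irreducible-generates f-irr (∣-comp-isLeftIdeal h p) h∤1 h∣fp

      module H = IsLeftIdeal (multiples-isLeftIdeal polynomialRing h)

      go : ∃[ t ] Nonzero t × h ∣ PS.sum (λ i → const (t i) *ₚ v i) → SolvableModulo f p
      go (t , (i , tᵢ≉0) , h∣Σ) with zero-or-unit (t zero)
      -- A relation without λ reads r(p) ≡ 0 modulo h with deg r < deg f. Then f divides r, so r = 0
      -- and the relation is trivial.
      ... | inj₁ t₀≈0 = ⊥-elim (tᵢ≉0 (t≈0 i))
        where
        r = tabulate (Vector.tail t)

        h∣rp : h ∣ comp r p
        h∣rp = ∣ʳ-respʳ-≈ (begin
          const (t zero) *ₚ indeterminate +ₚ PS.sum (λ i → const (t (suc i)) *ₚ p ^ toℕ i)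
            ≈⟨ +ₚ-cong (*ₚ-cong {q = indeterminate} (∷-zero t₀≈0 ≋-refl) ≋-refl) (≋-sym (comp-tabulate (Vector.tail t) p)) ⟩
          comp r p ∎) h∣Σ

        t≈0 : ∀ i → t i ≈ 0#
        t≈0 zero    = t₀≈0
        t≈0 (suc i) = tabulate-zero (Vector.tail t)
          (multiple-small⇒0 f-deg (generates h∣rp) (tabulate-vanishesFrom (Vector.tail t))) i
      ... | inj₂ (y , t₀y≈1) = q , ∣⇒≡-mod (generates h∣gp)
        where
        r = tabulate (Vector.tail t)
        q = solve-for-head y (Vector.tail t)

        λ≡qp : indeterminate ≡ comp q p [mod h ]
        λ≡qp = ∣⇒≡-mod (H.resp (begin
          const y *ₚ (const (t zero) *ₚ indeterminate +ₚ PS.sum (λ i → const (t (suc i)) *ₚ p ^ toℕ i))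
            ≈⟨ *ₚ-congˡ (const y) (+ₚ-cong (≋-refl {const (t zero) *ₚ indeterminate}) (≋-sym (comp-tabulate (Vector.tail t) p))) ⟩
          const y *ₚ (const (t zero) *ₚ indeterminate +ₚ comp r p)
            ≈⟨ solve 4 (λ y t x r → y :* (t :* x :+ r) := (t :* y) :* x :+ y :* r) ≋-refl
                 (const y) (const (t zero)) indeterminate (comp r p) ⟩
          const (t zero) *ₚ const y *ₚ indeterminate +ₚ const y *ₚ comp r p
            ≈⟨ +ₚ-cong (≋-trans (*ₚ-cong {q = indeterminate} (≋-trans (const-* (t zero) (const y)) (∷-cong t₀y≈1 ≋-refl)) ≋-refl) (*ₚ-identityˡ indeterminate))
                 (≋-sym (≋-trans (-ₚ-cong comp-q) (RingProperties.-‿involutive P.ring (const y *ₚ comp r p)))) ⟩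
          indeterminate +ₚ -ₚ comp q p ∎) (H.*-closed (const y) h∣Σ))
          where
          comp-q : comp q p ≋ -ₚ (const y *ₚ comp r p)
          comp-q = ≋-trans (comp-neg (y · r) p) (-ₚ-cong (comp-· y r p))

        h∣gp : h ∣ comp (comp p q +ₚ -ₚ indeterminate) p
        h∣gp = H.resp (≋-sym (begin
          comp (comp p q +ₚ -ₚ indeterminate) p
            ≈⟨ comp-+ (comp p q) (-ₚ indeterminate) p ⟩
          comp (comp p q) p +ₚ comp (-ₚ indeterminate) p
            ≈⟨ +ₚ-cong (comp-assoc p q p) (≋-trans (comp-neg indeterminate p) (-ₚ-cong (comp-indeterminateˡ p))) ⟩
          comp p (comp q p) +ₚ -ₚ p
            ≈⟨ +ₚ-cong (≋-refl {comp p (comp q p)}) (-ₚ-cong (≋-sym (comp-indeterminateʳ p))) ⟩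
          comp p (comp q p) +ₚ -ₚ comp p indeterminate ∎))
          (≡-mod⇒∣ (comp-cong-mod p (≡-mod-sym λ≡qp)))

    -- A polynomial h₀ annihilating q modulo f need not divide f(p), and f(p) may have too large a
    -- degree. Their gcd d still annihilates q modulo f, and this pins its degree from below.
    solvable⇒factor : SolvableModulo f p → ∃[ h ] HasDegree h (suc n) × h ∣ comp f p
    solvable⇒factor (q , pq≡λ) = go (dependent-mod f-deg (λ i → q ^ toℕ i))
      where
      J = λ g → f ∣ comp g q
      module J = IsLeftIdeal (∣-comp-isLeftIdeal f q)

      -- Composition is associative, so this is r applied to both sides of p(q(λ)) ≡ λ.
      rpq≡r : ∀ r → comp (comp r p) q ≡ r [mod f ]
      rpq≡r r with comp-cong-mod r pq≡λ
      ... | s , e = s , (begin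
        comp (comp r p) q                   ≈⟨ comp-assoc r p q ⟩
        comp r (comp p q)                   ≈⟨ e ⟩
        comp r indeterminate +ₚ s *ₚ f      ≈⟨ +ₚ-cong (comp-indeterminateʳ r) (≋-refl {s *ₚ f}) ⟩
        r +ₚ s *ₚ f                         ∎)

      module _ {t : Vector Carrier (suc (suc n))} (t≉0 : Nonzero t) (f∣h₀q : f ∣ comp (tabulate t) q)
        (b : Bézout (tabulate t) (comp f p)) where
        open Bézout b renaming (d∣f to d∣h₀ ; d∣g to d∣fp ; d≋uf+vg to d≋)

        h₀≋̸0 : ¬ tabulate t ≋ []
        h₀≋̸0 = tabulate-nonzero t t≉0

        -- `J` contains h₀ by its choice, and f(p) because f(p(q)) ≡ f; d is a combination of the
        -- two.
        Jd : J d
        Jd = J.resp (≋-sym d≋) (J.+-closed {u *ₚ tabulate t} {v *ₚ comp f p}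
          (J.*-closed u f∣h₀q) (J.*-closed v (∣-resp-mod (rpq≡r f) ∣ʳ-refl)))

        -- A factor of degree e < deg f would give a nonzero r of degree at
        -- most e with d ∣ r(p), and then f ∣ r(p(q)) ≡ r.
        no-small : ∀ {e} → e < suc n →
          ¬ (∃[ t ] Nonzero t × d ∣ PS.sum {suc e} (λ i → const (t i) *ₚ p ^ toℕ i))
        no-small {e} e<n (t , t≉0 , d∣Σ) = tabulate-nonzero t t≉0 (multiple-small⇒0 f-deg
            (∣-resp-mod (≡-mod-sym (rpq≡r r)) (J-multiple (∣ʳ-respʳ-≈ (≋-sym (comp-tabulate t p)) d∣Σ)))
            λ k n≤k → tabulate-vanishesFrom t k (ℕ.≤-trans e<n n≤k))
          where
          r = tabulate t

          J-multiple : ∀ {g} → d ∣ g → J g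
          J-multiple (w , wd≋g) = J.resp wd≋g (J.*-closed w Jd)

        zero-multiple : ∀ {g h} → g ≋ [] → g ∣ h → h ≋ []
        zero-multiple g≋0 (w , wg≋h) = ≋-trans (≋-sym wg≋h) (≋-trans (*ₚ-congˡ w g≋0) (*ₚ-zeroʳ w))

        factor : d ≋ [] ⊎ (∃[ e ] HasDegree d e) → ∃[ h ] HasDegree h (suc n) × h ∣ comp f p
        factor (inj₁ d≋0) = ⊥-elim (h₀≋̸0 (zero-multiple d≋0 d∣h₀))
        factor (inj₂ (e , d-deg)) with ℕ.<-cmp e (suc n)
        ... | tri< e<n _ _    = ⊥-elim (no-small e<n (dependent-mod d-deg (λ i → p ^ toℕ i)))
        ... | tri≈ _ ≡.refl _ = d , d-deg , d∣fp
        -- h₀ has `suc (suc n)` coefficients, hence degree at most `suc n`, too small for a nonzero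
        -- multiple of d.
        ... | tri> _ _ n<e    = ⊥-elim (h₀≋̸0 (multiple-small⇒0 d-deg d∣h₀
                                  λ k e≤k → tabulate-vanishesFrom t k (ℕ.≤-trans n<e e≤k)))

      go : ∃[ t ] Nonzero t × f ∣ PS.sum (λ i → const (t i) *ₚ q ^ toℕ i) →
           ∃[ h ] HasDegree h (suc n) × h ∣ comp f p
      go (t , t≉0 , f∣Σ) = factor t≉0 (∣ʳ-respʳ-≈ (≋-sym (comp-tabulate t q)) f∣Σ) b (degree? (Bézout.d b))
        where b = bézout (tabulate t) (comp f p)

-- The equivalence with (i).

module MatrixEquation {c ℓ} (K : DiscreteField c ℓ) {n : ℕ}
  (A : Matrices.Matrix (DiscreteField.rawRing K) (suc n)) where
  open DiscreteField K
  open Polynomial rawRing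
  open PolynomialRing commutativeRing
  open Composition commutativeRing
  open LinearDependence K
  open Euclidean K
  open IrreduciblePolynomial K
  open Matrices rawRing using (Matrix; scalar)
  open MatrixRing commutativeRing
  open EvaluationAtMatrix commutativeRing (suc n)
  open CayleyHamilton commutativeRing A
  private
    module P = CommutativeRing polynomialRing
    module M = Ring (ring-of-matrices (suc n))
    module MS = SemiringSum M.semiring
    module Mᴿ = RawSemiringDefinitions (Semiring.rawSemiring M.semiring)
  open SemiringSum semiring using (sum-syntax; sum-cong-≋)
  open RawSemiringDefinitions (Semiring.rawSemiring P.semiring) using (Irreducible)
  open SemiringDivisibility P.semiring using (_∣_)
  open Congruence polynomialRing
  open Determinant commutativeRing using (sum-zero)
  open AbelianGroupProperties +-abelianGroup using (inverseˡ-unique)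
  open RingSolver commutativeSemiring using (solve; _:+_; _:*_; _:=_)
  open SetoidReasoning setoid

  infix 4 _≈₀_
  -- This is M e₀ = N e₀, so it is preserved by multiplication from the left.
  _≈₀_ : Matrix (suc n) → Matrix (suc n) → Set ℓ
  M ≈₀ N = ∀ r → M r zero ≈ N r zero

  ≈₀-*ˡ : ∀ U M N → M ≈₀ N → U M.* M ≈₀ U M.* N
  ≈₀-*ˡ U M N e r = sum-cong-≋ {suc n} λ k → *-congˡ {U r k} (e k)

  first-column-isLeftIdeal : IsLeftIdeal (ring-of-matrices (suc n)) (_≈₀ M.0#)
  first-column-isLeftIdeal = record
    { resp     = λ e z r → trans (sym (e r zero)) (z r)
    ; +-closed = λ y z r → trans (+-cong (y r) (z r)) (+-identityʳ 0#)
    ; *-closed = λ U {M} z r → trans (≈₀-*ˡ U M M.0# z r) (M.zeroʳ U r zero) }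

  annihilator : IsLeftIdeal P.ring (λ g → ⟦ g ⟧ A ≈₀ M.0#)
  annihilator = preimage-isLeftIdeal first-column-isLeftIdeal A

  sum-entry : ∀ {m} (v : Vector (Matrix (suc n)) m) r s → MS.sum v r s ≈ ∑[ i < m ] v i r s
  sum-entry {zero}  v r s = refl
  sum-entry {suc m} v r s = +-congˡ (sum-entry (Vector.tail v) r s)

  ⟦⟧-tabulate-entry : ∀ {m} (t : Vector Carrier m) r s →
    ⟦ tabulate t ⟧ A r s ≈ ∑[ i < m ] (t i * (A Mᴿ.^ toℕ i) r s)
  ⟦⟧-tabulate-entry {m} t r s = begin
    ⟦ tabulate t ⟧ A r s
      ≈⟨ ⟦⟧-tabulate t A r s ⟩
    MS.sum (λ i → scalar (t i) M.* A Mᴿ.^ toℕ i) r s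
      ≈⟨ sum-entry (λ i → scalar (t i) M.* A Mᴿ.^ toℕ i) r s ⟩
    ∑[ i < m ] (scalar (t i) M.* A Mᴿ.^ toℕ i) r s
      ≈⟨ sum-cong-≋ {m} (λ i → scalar-*ˡ (t i) (λ k → (A Mᴿ.^ toℕ i) k s) r) ⟩
    ∑[ i < m ] (t i * (A Mᴿ.^ toℕ i) r s) ∎

  f-deg : HasDegree f (suc n)
  f-deg = let (v , e) = CharacteristicPolynomialDegree.charPoly-monic commutativeRing A in
    (λ z → 1≉0 (trans (sym e) z)) , v

  module _ (f-irr : Irreducible f) where

    annihilates⇒∣ : ∀ {g} → ⟦ g ⟧ A ≈₀ M.0# → f ∣ g
    annihilates⇒∣ = irreducible-generates f-irr annihilator
      -- The annihilator of e₀ is proper: the top left entry of I is 1.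
      (λ z → 1≉0 (trans (sym (⟦⟧-1 A zero zero)) (z zero))) first-column-zero

    -- The vectors w, e₀, A e₀, ..., Aⁿ e₀ are one more than the dimension plus zero, hence
    -- dependent. If w had coefficient zero, a nonzero polynomial of degree below deg f would
    -- annihilate e₀.
    cyclic : ∀ (w : Vector Carrier (suc n)) → ∃[ q ] (∀ r → w r ≈ ⟦ q ⟧ A r zero)
    cyclic w = go (dependent (suc n) v)
      where
      v : Vector (Vector Carrier (suc n)) (suc (suc n))
      v = w Vector.∷ λ i r → (A Mᴿ.^ toℕ i) r zero

      go : ∃[ t ] Nonzero t × (∀ k → ∑[ i < suc (suc n) ] (t i * v i k) ≈ 0#) →
           ∃[ q ] (∀ r → w r ≈ ⟦ q ⟧ A r zero)
      go (t , (i , tᵢ≉0) , e) with zero-or-unit (t zero)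
      ... | inj₁ t₀≈0 = ⊥-elim (tᵢ≉0 (t≈0 i))
        where
        r = tabulate (Vector.tail t)

        rA≈0 : ⟦ r ⟧ A ≈₀ M.0#
        rA≈0 k = begin
          ⟦ r ⟧ A k zero                      ≈⟨ +-identityˡ _ ⟨
          0# + ⟦ r ⟧ A k zero                 ≈⟨ +-cong (sym (trans (*-congʳ t₀≈0) (zeroˡ (w k)))) (⟦⟧-tabulate-entry (Vector.tail t) k zero) ⟩
          ∑[ i < suc (suc n) ] (t i * v i k)  ≈⟨ e k ⟩
          0#                                  ∎

        t≈0 : ∀ i → t i ≈ 0#
        t≈0 zero    = t₀≈0
        t≈0 (suc i) = tabulate-zero (Vector.tail t)
          (multiple-small⇒0 f-deg (annihilates⇒∣ {r} rA≈0) (tabulate-vanishesFrom (Vector.tail t))) i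
      ... | inj₂ (y , t₀y≈1) = solve-for-head y (Vector.tail t) , λ k → begin
          w k
            ≈⟨ inverseˡ-unique (w k) (y * ⟦ r ⟧ A k zero) (w+yr≈0 k) ⟩
          - (y * ⟦ r ⟧ A k zero)
            ≈⟨ -‿cong (trans (⟦⟧-· y r A k zero) (scalar-*ˡ y (λ i → ⟦ r ⟧ A i zero) k)) ⟨
          - ⟦ y · r ⟧ A k zero
            ≈⟨ ⟦⟧-neg (y · r) A k zero ⟨
          ⟦ -ₚ (y · r) ⟧ A k zero ∎
        where
        r = tabulate (Vector.tail t)

        w+yr≈0 : ∀ k → w k + y * ⟦ r ⟧ A k zero ≈ 0#
        w+yr≈0 k = begin
          w k + y * ⟦ r ⟧ A k zero
            ≈⟨ +-congʳ (trans (sym (*-identityˡ _)) (*-congʳ (sym t₀y≈1))) ⟩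
          (t zero * y) * w k + y * ⟦ r ⟧ A k zero
            ≈⟨ solve 4 (λ t y w r → (t :* y) :* w :+ y :* r := y :* (t :* w :+ r)) refl (t zero) y (w k) (⟦ r ⟧ A k zero) ⟩
          y * (t zero * w k + ⟦ r ⟧ A k zero)
            ≈⟨ *-congˡ (trans (+-congˡ (⟦⟧-tabulate-entry (Vector.tail t) k zero)) (e k)) ⟩
          y * 0#
            ≈⟨ zeroʳ y ⟩
          0# ∎

    -- Each basis vector is eⱼ = q(A) e₀ for some q, and f(A) q(A) e₀ = q(A) f(A) e₀ = 0.
    cayley-hamilton : ⟦ f ⟧ A M.≈ M.0#
    cayley-hamilton i j with cyclic (λ r → scalar 1# r j)
    ... | q , e = begin
      ⟦ f ⟧ A i j
        ≈⟨ trans (scalar-*ʳ 1# (⟦ f ⟧ A i) j) (*-identityʳ _) ⟨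
      ∑[ k < suc n ] (⟦ f ⟧ A i k * scalar 1# k j)
        ≈⟨ sum-cong-≋ {suc n} (λ k → *-congˡ {⟦ f ⟧ A i k} (e k)) ⟩
      (⟦ f ⟧ A M.* ⟦ q ⟧ A) i zero
        ≈⟨ ⟦⟧-* f q A i zero ⟨
      ⟦ f *ₚ q ⟧ A i zero
        ≈⟨ ⟦⟧-congˡ A (*ₚ-comm f q) i zero ⟩
      ⟦ q *ₚ f ⟧ A i zero
        ≈⟨ IsLeftIdeal.*-closed annihilator q {f} first-column-zero i ⟩
      0# ∎

    solvable⇒matrix-solution : ∀ p → SolvableModulo f p → ∃[ X ] ⟦ p ⟧ X M.≈ A
    solvable⇒matrix-solution p (q , s , pq≋λ+sf) = ⟦ q ⟧ A , λ i j → begin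
      ⟦ p ⟧ (⟦ q ⟧ A) i j
        ≈⟨ ⟦⟧-comp p q A i j ⟨
      ⟦ comp p q ⟧ A i j
        ≈⟨ ⟦⟧-congˡ A pq≋λ+sf i j ⟩
      ⟦ indeterminate +ₚ s *ₚ f ⟧ A i j
        ≈⟨ ⟦⟧-+ indeterminate (s *ₚ f) A i j ⟩
      ⟦ indeterminate ⟧ A i j + ⟦ s *ₚ f ⟧ A i j
        ≈⟨ +-cong (⟦⟧-indeterminate A i j) (⟦⟧-* s f A i j) ⟩
      A i j + (⟦ s ⟧ A M.* ⟦ f ⟧ A) i j
        ≈⟨ +-congˡ (sum-zero {suc n} λ k → trans (*-congˡ {⟦ s ⟧ A i k} (cayley-hamilton k j)) (zeroʳ _)) ⟩
      A i j + 0#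
        ≈⟨ +-identityʳ _ ⟩
      A i j ∎

    matrix-solution⇒solvable : ∀ p → ∃[ X ] ⟦ p ⟧ X M.≈ A → SolvableModulo f p
    matrix-solution⇒solvable p (X , pX≈A) with cyclic (λ r → X r zero)
    ... | q , Xe≈qAe = q , ∣⇒≡-mod (annihilates⇒∣ {comp p q +ₚ -ₚ indeterminate} vanishes)
      where
      -- A is p(X), a polynomial in X.
      X-commutes-A : X M.* A M.≈ A M.* X
      X-commutes-A = M.trans (M.*-congˡ {X} {A} {⟦ p ⟧ X} (M.sym {⟦ p ⟧ X} {A} pX≈A))
        (M.trans (⟦⟧-commutes p {X} {X} (M.refl {X M.* X})) (M.*-congʳ {X} {⟦ p ⟧ X} {A} pX≈A))

      -- X and q(A) are known to agree on e₀ only, so X has to stand next to e₀ before it can be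
      -- replaced: with G = s(q(A)), X G e₀ = G X e₀ = G q(A) e₀.
      transfer : ∀ s → ⟦ s ⟧ X ≈₀ ⟦ comp s q ⟧ A
      transfer []      r = refl
      transfer (x ∷ s) r = begin
        scalar x r zero + (X M.* ⟦ s ⟧ X) r zero
          ≈⟨ +-congˡ (≈₀-*ˡ X (⟦ s ⟧ X) G (transfer s) r) ⟩
        scalar x r zero + (X M.* G) r zero
          ≈⟨ +-congˡ (⟦⟧-commutes (comp s q) {A} {X} X-commutes-A r zero) ⟩
        scalar x r zero + (G M.* X) r zero
          ≈⟨ +-congˡ (≈₀-*ˡ G X (⟦ q ⟧ A) Xe≈qAe r) ⟩
        scalar x r zero + (G M.* ⟦ q ⟧ A) r zero
          ≈⟨ +-congˡ (⟦⟧-* (comp s q) q A r zero) ⟨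
        scalar x r zero + ⟦ comp s q *ₚ q ⟧ A r zero
          ≈⟨ +-cong (sym (⟦⟧-const x A r zero)) (⟦⟧-congˡ A (*ₚ-comm (comp s q) q) r zero) ⟩
        ⟦ const x ⟧ A r zero + ⟦ q *ₚ comp s q ⟧ A r zero
          ≈⟨ ⟦⟧-+ (const x) (q *ₚ comp s q) A r zero ⟨
        ⟦ comp (x ∷ s) q ⟧ A r zero ∎
        where G = ⟦ comp s q ⟧ A

      vanishes : ⟦ comp p q +ₚ -ₚ indeterminate ⟧ A ≈₀ M.0#
      vanishes r = begin
        ⟦ comp p q +ₚ -ₚ indeterminate ⟧ A r zero
          ≈⟨ ⟦⟧-+ (comp p q) (-ₚ indeterminate) A r zero ⟩
        ⟦ comp p q ⟧ A r zero + ⟦ -ₚ indeterminate ⟧ A r zero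
          ≈⟨ +-cong (trans (sym (transfer p r)) (pX≈A r zero))
               (trans (⟦⟧-neg indeterminate A r zero) (-‿cong (⟦⟧-indeterminate A r zero))) ⟩
        A r zero + - A r zero
          ≈⟨ -‿inverseʳ _ ⟩
        0# ∎

-- Translation between the two forms of polynomial equality, and the field ℚ.

module CoefficientwiseDivisibility {c ℓ} (R : CommutativeRing c ℓ) where
  open Polynomial (CommutativeRing.rawRing R) using (polyRing)
  open PolynomialRing R
  private
    module Raw = RawSemiringDefinitions (RawRing.rawSemiring polyRing)
    module P = CommutativeRing polynomialRing
    module Wrapped = RawSemiringDefinitions (Semiring.rawSemiring P.semiring)

  ∣-wrap : ∀ {p q} → p Raw.∣ q → p Wrapped.∣ q
  ∣-wrap (s , e) = s , coeffwise e

  ∣-unwrap : ∀ {p q} → p Wrapped.∣ q → p Raw.∣ q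
  ∣-unwrap (s , e) = s , at e

  irreducible-wrap : ∀ {p} → Raw.Irreducible p → Wrapped.Irreducible p
  irreducible-wrap (Raw.mkIrred p∤1 split) = Wrapped.mkIrred (λ p∣1 → p∤1 (∣-unwrap p∣1))
    (λ p≋xy → Sum.map ∣-wrap ∣-wrap (split (at p≋xy)))

ℚ-discreteField : DiscreteField 0ℓ 0ℓ
ℚ-discreteField = record
  { commutativeRing = ℚ.+-*-commutativeRing
  ; 1≉0 = λ ()
  ; zero-or-unit = zero-or-unit }
  where

  zero-or-unit : ∀ x → x ≡ 0ℚ ⊎ (∃[ y ] x ℚ.* y ≡ 1ℚ)
  zero-or-unit x with x ℚ.≟ 0ℚ
  ... | yes x≡0 = inj₁ x≡0
  ... | no x≢0  = inj₂ (_ , ℚ.*-inverseʳ x {{ℚ.≢-nonZero x≢0}})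

-- The equivalence with (iii).

module Closure {c ℓ₁ ℓ₂} (ℚ̄ : AlgebraicClosureOfℚ c ℓ₁ ℓ₂) where
  open AlgebraicClosureOfℚ ℚ̄ using (heytingField; ι; ι-homomorphism; evalAt; closed; ℚ⟨_⟩;
    rational; generator; sum; negative; product; inverse; respects)
  private
    module HF = HeytingField heytingField
    L : CommutativeRing c ℓ₁
    L = HeytingCommutativeRing.commutativeRing HF.heytingCommutativeRing
    module K = DiscreteField ℚ-discreteField
    module ι = IsRingHomomorphism ι-homomorphism
  open CommutativeRing L hiding (zero)
  open Polynomial +-*-rawRing using (coeff; const; indeterminate; HasDegree; _+ₚ_; _*ₚ_; -ₚ_)
  open PolynomialRing K.commutativeRing
  open Composition K.commutativeRing
  open IrreduciblePolynomial ℚ-discreteField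
  private
    module P = CommutativeRing polynomialRing
    module Lₚ = Polynomial rawRing
  open RawSemiringDefinitions (Semiring.rawSemiring P.semiring) using (Irreducible)
  open SemiringDivisibility P.semiring using (_∣_)
  open Congruence polynomialRing
  open Evaluation K.commutativeRing ring ι ι-homomorphism (λ r x → *-comm (ι r) x)
  open EvaluateComposition K.commutativeRing ring ι ι-homomorphism (λ r x → *-comm (ι r) x)
  open SetoidReasoning setoid

  -- 1 - 0 is invertible, so 1 is apart from 0, and apartness is irreflexive.
  1≉0 : ¬ 1# ≈ 0#
  1≉0 1≈0 = HF.#-irrefl 1≈0 (HF.invertible⇒# (1# , 1*[1-0]≈1 , trans (*-comm _ _) 1*[1-0]≈1))
    where
    1*[1-0]≈1 : 1# * (1# - 0#) ≈ 1#
    1*[1-0]≈1 = trans (*-identityˡ _) (trans (+-congˡ (RingProperties.-0#≈0# ring)) (+-identityʳ 1#))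

  ι-≉0 : ∀ {r} → ¬ r K.≈ 0ℚ → ¬ ι r ≈ 0#
  ι-≉0 {r} r≉0 ιr≈0 with K.zero-or-unit r
  ... | inj₁ r≈0 = r≉0 r≈0
  ... | inj₂ (s , rs≈1) = 1≉0 (begin
    1#            ≈⟨ ι.1#-homo ⟨
    ι 1ℚ          ≈⟨ ι.⟦⟧-cong rs≈1 ⟨
    ι (r K.* s)   ≈⟨ ι.*-homo r s ⟩
    ι r * ι s     ≈⟨ *-congʳ ιr≈0 ⟩
    0# * ι s      ≈⟨ zeroˡ _ ⟩
    0#            ∎)

  coeff-map-ι : ∀ p k → Lₚ.coeff (map ι p) k ≈ ι (coeff p k)
  coeff-map-ι []      k       = sym ι.0#-homo
  coeff-map-ι (a ∷ p) zero    = refl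
  coeff-map-ι (a ∷ p) (suc k) = coeff-map-ι p k

  eval-map-ι : ∀ p x → Lₚ.eval rawRing (λ a → a) (map ι p) x ≈ evalAt p x
  eval-map-ι []      x = refl
  eval-map-ι (a ∷ p) x = +-congˡ (*-congˡ (eval-map-ι p x))

  root : ∀ {f n} → HasDegree f (suc n) → ∃[ μ ] evalAt f μ ≈ 0#
  root {f} {n} (fₙ≉0 , v) with closed n (map ι f)
    ( (λ e → ι-≉0 fₙ≉0 (trans (sym (coeff-map-ι f (suc n))) e))
    , λ k n<k → trans (coeff-map-ι f k) (trans (ι.⟦⟧-cong (v k n<k)) ι.0#-homo))
  ... | μ , e = μ , trans (sym (eval-map-ι f μ)) e

  evalAt∈ℚ⟨⟩ : ∀ q μ → evalAt q μ ∈ ℚ⟨ μ ⟩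
  evalAt∈ℚ⟨⟩ []      μ = respects ι.0#-homo (rational 0ℚ)
  evalAt∈ℚ⟨⟩ (a ∷ q) μ = sum (rational a) (product generator (evalAt∈ℚ⟨⟩ q μ))

  module _ {f} (f-irr : Irreducible f) where

    root⇒∣ : ∀ {μ g} → evalAt f μ ≈ 0# → evalAt g μ ≈ 0# → f ∣ g
    root⇒∣ {μ} f≈0 g≈0 = irreducible-generates f-irr
      (preimage-isLeftIdeal (zero-isLeftIdeal L) μ)
      (λ 1≈0 → 1≉0 (trans (sym (⟦⟧-1 μ)) 1≈0)) f≈0 g≈0

    module _ {μ} (f[μ]≈0 : evalAt f μ ≈ 0#) where

      -- f cannot divide r, since then r(μ) = 0. Otherwise u f + v r = 1, and evaluation at μ gives
      -- v(μ) r(μ) = 1. This is why inverses in ℚ(μ) are again polynomials in μ.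
      inverse-at-root : ∀ r {y} → evalAt r μ * y ≈ 1# → ∃[ v ] evalAt v μ ≈ y
      inverse-at-root r {y} ry≈1 with irreducible-∣-or-coprime f-irr r
      ... | inj₁ (s , sf≋r) = ⊥-elim (1≉0 (begin
        1#                           ≈⟨ ry≈1 ⟨
        evalAt r μ * y               ≈⟨ *-congʳ (⟦⟧-congˡ μ sf≋r) ⟨
        evalAt (s *ₚ f) μ * y        ≈⟨ *-congʳ (trans (⟦⟧-* s f μ) (trans (*-congˡ f[μ]≈0) (zeroʳ _))) ⟩
        0# * y                       ≈⟨ zeroˡ y ⟩
        0#                           ∎))
      ... | inj₂ (u , v , uf+vr≋1) = v , (begin
        evalAt v μ                             ≈⟨ *-identityʳ _ ⟨
        evalAt v μ * 1#                        ≈⟨ *-congˡ ry≈1 ⟨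
        evalAt v μ * (evalAt r μ * y)          ≈⟨ *-assoc _ _ _ ⟨
        evalAt v μ * evalAt r μ * y            ≈⟨ *-congʳ vr≈1 ⟩
        1# * y                                 ≈⟨ *-identityˡ y ⟩
        y                                      ∎)
        where
        vr≈1 : evalAt v μ * evalAt r μ ≈ 1#
        vr≈1 = begin
          evalAt v μ * evalAt r μ
            ≈⟨ +-identityˡ _ ⟨
          0# + evalAt v μ * evalAt r μ
            ≈⟨ +-congʳ (trans (*-congˡ f[μ]≈0) (zeroʳ _)) ⟨
          evalAt u μ * evalAt f μ + evalAt v μ * evalAt r μ
            ≈⟨ +-cong (⟦⟧-* u f μ) (⟦⟧-* v r μ) ⟨
          evalAt (u *ₚ f) μ + evalAt (v *ₚ r) μ
            ≈⟨ ⟦⟧-+ (u *ₚ f) (v *ₚ r) μ ⟨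
          evalAt (u *ₚ f +ₚ v *ₚ r) μ
            ≈⟨ ⟦⟧-congˡ μ uf+vr≋1 ⟩
          evalAt (const 1ℚ) μ
            ≈⟨ ⟦⟧-1 μ ⟩
          1# ∎

      ℚ⟨⟩⇒evalAt : ∀ {γ} → γ ∈ ℚ⟨ μ ⟩ → ∃[ q ] evalAt q μ ≈ γ
      ℚ⟨⟩⇒evalAt (rational a) = const a , ⟦⟧-const a μ
      ℚ⟨⟩⇒evalAt generator    = indeterminate , ⟦⟧-indeterminate μ
      ℚ⟨⟩⇒evalAt (sum x y) with ℚ⟨⟩⇒evalAt x | ℚ⟨⟩⇒evalAt y
      ... | p , e | q , e′ = p +ₚ q , trans (⟦⟧-+ p q μ) (+-cong e e′)
      ℚ⟨⟩⇒evalAt (negative x) with ℚ⟨⟩⇒evalAt x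
      ... | p , e = -ₚ p , trans (⟦⟧-neg p μ) (-‿cong e)
      ℚ⟨⟩⇒evalAt (product x y) with ℚ⟨⟩⇒evalAt x | ℚ⟨⟩⇒evalAt y
      ... | p , e | q , e′ = p *ₚ q , trans (⟦⟧-* p q μ) (*-cong e e′)
      ℚ⟨⟩⇒evalAt (inverse x xy≈1) with ℚ⟨⟩⇒evalAt x
      ... | p , e = inverse-at-root p (trans (*-congʳ e) xy≈1)
      ℚ⟨⟩⇒evalAt (respects x≈y x) with ℚ⟨⟩⇒evalAt x
      ... | p , e = p , trans e x≈y

    -- With γ = q(μ), the polynomial p(q(λ)) - λ vanishes at μ and is therefore a multiple of f.
    rootInField⇒solvable : ∀ p → ∃[ μ ] ∃[ γ ] evalAt f μ ≈ 0# × γ ∈ ℚ⟨ μ ⟩ × evalAt p γ ≈ μ →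
                           SolvableModulo f p
    rootInField⇒solvable p (μ , γ , f≈0 , γ∈ℚ⟨μ⟩ , pγ≈μ) with ℚ⟨⟩⇒evalAt f≈0 γ∈ℚ⟨μ⟩
    ... | q , qμ≈γ = q , ∣⇒≡-mod (root⇒∣ {μ} {comp p q +ₚ -ₚ indeterminate} f≈0 (begin
      evalAt (comp p q +ₚ -ₚ indeterminate) μ
        ≈⟨ ⟦⟧-+ (comp p q) (-ₚ indeterminate) μ ⟩
      evalAt (comp p q) μ + evalAt (-ₚ indeterminate) μ
        ≈⟨ +-cong (trans (⟦⟧-comp p q μ) (trans (⟦⟧-congʳ p qμ≈γ) pγ≈μ))
             (trans (⟦⟧-neg indeterminate μ) (-‿cong (⟦⟧-indeterminate μ))) ⟩
      μ + - μ
        ≈⟨ -‿inverseʳ μ ⟩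
      0# ∎))

  -- Any root μ of f will do: at μ the congruence p(q(λ)) ≡ λ becomes an equality.
  solvable⇒rootInField : ∀ {f n} → HasDegree f (suc n) → ∀ p → SolvableModulo f p →
    ∃[ μ ] ∃[ γ ] evalAt f μ ≈ 0# × γ ∈ ℚ⟨ μ ⟩ × evalAt p γ ≈ μ
  solvable⇒rootInField {f} f-deg p (q , s , pq≋λ+sf) with root {f} f-deg
  ... | μ , f≈0 = μ , evalAt q μ , f≈0 , evalAt∈ℚ⟨⟩ q μ , (begin
    evalAt p (evalAt q μ)
      ≈⟨ ⟦⟧-comp p q μ ⟨
    evalAt (comp p q) μ
      ≈⟨ ⟦⟧-congˡ μ pq≋λ+sf ⟩
    evalAt (indeterminate +ₚ s *ₚ f) μ
      ≈⟨ ⟦⟧-+ indeterminate (s *ₚ f) μ ⟩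
    evalAt indeterminate μ + evalAt (s *ₚ f) μ
      ≈⟨ +-cong (⟦⟧-indeterminate μ) (trans (⟦⟧-* s f μ) (trans (*-congˡ f≈0) (zeroʳ _))) ⟩
    μ + 0#
      ≈⟨ +-identityʳ μ ⟩
    μ ∎)

-- The three equivalences combined.

open import Defs using (_∣_; Irreducible)

theorem4 : ∀ {c ℓ₁ ℓ₂ : Level} (ℚ̄ : AlgebraicClosureOfℚ c ℓ₁ ℓ₂) →
    let open AlgebraicClosureOfℚ ℚ̄ in
    (n : ℕ) (p : ℚ[λ]) (A : Matℚ n) → Irreducible (charPoly A) →
    ((∃[ X ] evalMat p X ≈ₘ A)
    ⇔ (∃[ h ] HasDegreeℚ h n × h ∣ (charPoly A ∘ₚ p)))
    × ((∃[ h ] HasDegreeℚ h n × h ∣ (charPoly A ∘ₚ p))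
    ⇔ (∃[ μ ] ∃[ γ ] μ ∈ σ A × γ ∈ ℚ⟨ μ ⟩ × evalAt p γ ≈ μ))
theorem4 ℚ̄ zero p A (RawSemiringDefinitions.mkIrred f∤1 _) =
  -- The determinant of the empty matrix is 1, a unit, so for n = 0 the characteristic polynomial is
  -- not irreducible.
  ⊥-elim (f∤1 (charPoly A , at (*ₚ-identityˡ (charPoly A))))
  where open PolynomialRing ℚ.+-*-commutativeRing
theorem4 ℚ̄ (suc n) p A irreducible =
  mk⇔ (λ i → solvable⇒ii (matrix-solution⇒solvable f-irr p i))
      (λ ii → solvable⇒matrix-solution f-irr p (ii⇒solvable ii)) ,
  mk⇔ (λ ii → solvable⇒rootInField f-deg p (ii⇒solvable ii))
      (λ iii → solvable⇒ii (rootInField⇒solvable f-irr p iii))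
  where
  open CoefficientwiseDivisibility ℚ.+-*-commutativeRing
  open IrreduciblePolynomial ℚ-discreteField
  open MatrixEquation ℚ-discreteField A
  open Closure ℚ̄

  f-irr = irreducible-wrap irreducible

  solvable⇒ii : SolvableModulo (charPoly A) p → ∃[ h ] HasDegreeℚ h (suc n) × h ∣ (charPoly A ∘ₚ p)
  solvable⇒ii s = let (h , h-deg , h∣fp) = solvable⇒factor f-irr f-deg p s in h , h-deg , ∣-unwrap h∣fp

  ii⇒solvable : ∃[ h ] HasDegreeℚ h (suc n) × h ∣ (charPoly A ∘ₚ p) → SolvableModulo (charPoly A) p
  ii⇒solvable (h , h-deg , h∣fp) = factor⇒solvable f-irr f-deg p (h , h-deg , ∣-wrap h∣fp)
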